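{- At least half of the instances of the proximate neighbors problem of size $N$ require $\Omega(\mathrm{perm}_P(N,M,B))$ parallel I/Os in the CREW atomic PEM model with $P<\frac{N}{B}$ processors.
   Context: The PEM (parallel external memory) model has $P$ processors, each with a private cache of $M$ memory cells, and a shared memory of unbounded size partitioned into blocks of $B$ contiguous cells. In one parallel I/O, each processor may transfer (read or write) at most one block between the shared memory and its cache. CREW: concurrent reads of a block allowed, writes exclusive. The cost is the number of parallel I/Os. In the atomic PEM model, every input element is an indivisible atom occupying one memory cell and revealing no information about its content; the only operations are I/Os, copying atoms and deleting atoms. A block permutation describes the content of the shared memory as a set of at most $B$ atoms for each block. An instance of the proximate neighbors problem of size $N$ consists of atoms $x_i$, $i\in[N]$, initially in shared memory, together with a labeling $\lambda:[N]\to[\frac N2]$ with $|\lambda^{ -1}(i)|=2$ for every $i$. An output block permutation solves the instance if for every $i\in[\frac N2]$ the two atoms with label $i$ are stored in the same block (blocks may contain fewer than $B$ atoms). Notation: $\overline{\log}(x)=\max\{1,\log x\}$, $d=\max\{2,\min\{\frac{M}{B},\frac{N}{PB}\}\}$, $\mathrm{perm}_P(N,M,B)=\min\left\{\frac{N}{P},\ \frac{N}{PB}\,\overline{\log}_d\frac{N}{B}\right\}$. -}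

module Defs where

open import Data.Nat using (ℕ; zero; suc; _+_; _*_; _<_; _≤_; _/_; _⊔_; _⊓_; NonZero; _≡ᵇ_)
open import Data.Nat.Logarithm using (⌊log₂_⌋)
open import Data.Fin using (Fin; toℕ)
open import Data.Fin.Subset using (Subset; _∈_; _⊆_; _∪_; ∣_∣)
open import Data.Vec using (Vec; []; _∷_; lookup; tabulate; count)
open import Data.List using (List; []; _∷_; length; filter; concatMap; foldr)
open import Data.List.Relation.Unary.All using (All)
open import Data.List.Relation.Unary.Unique.Propositional using (Unique)
open import Data.List using (allFin) renaming (map to mapL)
open import Data.Fin.Properties using (_≟_)
open import Data.Nat.Properties using (m*n≢0) renaming (_≟_ to _≟ℕ_)
open import Data.Product using (Σ; ∃; _×_; _,_)
open import Data.Maybe using (Maybe; just; nothing)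
open import Data.Bool using (Bool; true; false; if_then_else_)
open import Relation.Binary.PropositionalEquality using (_≡_)
open import Relation.Nullary using (Dec; yes; no)
open import Relation.Nullary.Decidable using (⌊_⌋)
open import Data.Vec.Relation.Unary.All using () renaming (All to AllV)

-- Instances of proximate neighbors of size N = 2n.
-- Atoms are Fin (2n); a labeling λ : [N] → [N/2] is a vector of labels
-- (Fin n) of length 2n; it is valid iff every label occurs exactly twice.

Labeling : ℕ → Set
Labeling n = Vec (Fin n) (2 * n)

ValidLabeling : (n : ℕ) → Labeling n → Set
ValidLabeling n λ' = (j : Fin n) → count (_≟ j) λ' ≡ 2

allVecs : (k m : ℕ) → List (Vec (Fin k) m)
allVecs k zero = [] ∷ []
allVecs k (suc m) = concatMap (λ x → mapL (x ∷_) (allVecs k m)) (allFin k)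

validLabeling? : (n : ℕ) → (λ' : Labeling n) → Dec (AllV (λ j → count (_≟ j) λ' ≡ 2) (tabulate {n = n} (λ j → j)))
validLabeling? n λ' = Data.Vec.Relation.Unary.All.all? (λ j → count (_≟ j) λ' ≟ℕ 2) (tabulate (λ j → j))

-- number of instances of size 2n (= (2n)!/2^n)
numInstances : ℕ → ℕ
numInstances n = length (filter (validLabeling? n) (allVecs n (2 * n)))

-- The CREW atomic PEM model with P processors, cache size M, block size B,
-- on the atoms Fin N.  Contents of blocks and caches are sets of atoms.

record Config (N P : ℕ) : Set where
  field
    mem   : ℕ → Subset N          -- shared memory: content of block b
    cache : Fin P → Subset N

data Act (N : ℕ) : Set where
  idle : Act N
  rd   : ℕ → Act N
  wr   : ℕ → Subset N → Act N

-- one parallel I/O: first free local operations (deleting atoms from the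
-- cache; copying inside the cache does not change its set of atoms),
-- then at most one block transfer per processor.
record IOStep (N P : ℕ) : Set where
  field
    keep : Fin P → Subset N
    act  : Fin P → Act N

written : {N P : ℕ} → (Fin P → Act N) → ℕ → Maybe (Subset N)
written {N} {P} a b = foldr f nothing (allFin P)
  where
  f : Fin P → Maybe (Subset N) → Maybe (Subset N)
  f p r with a p
  ... | wr b' S = if ⌊ b' ≟ℕ b ⌋ then just S else r
  ... | _ = r

applyStep : {N P : ℕ} → Config N P → IOStep N P → Config N P
applyStep {N} {P} c s = record { mem = mem' ; cache = cache' }
  where
  open Config c
  open IOStep s
  cache' : Fin P → Subset N
  cache' p with act p
  ... | rd b = keep p ∪ mem b
  ... | _ = keep p
  mem' : ℕ → Subset N
  mem' b with written act b
  ... | just S = S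
  ... | nothing = mem b

record ValidStep {N P : ℕ} (M B : ℕ) (c : Config N P) (s : IOStep N P) : Set where
  open Config c
  open IOStep s
  field
    keepSub   : ∀ p → keep p ⊆ cache p
    readFits  : ∀ p b → act p ≡ rd b → ∣ keep p ∪ mem b ∣ ≤ M
    writeSub  : ∀ p b S → act p ≡ wr b S → S ⊆ keep p
    writeSize : ∀ p b S → act p ≡ wr b S → ∣ S ∣ ≤ B
    exclusive : ∀ p q b S S' → act p ≡ wr b S → act q ≡ wr b S' → p ≡ q

run : {N P : ℕ} → Config N P → List (IOStep N P) → Config N P
run c [] = c
run c (s ∷ ss) = run (applyStep c s) ss

ValidRun : {N P : ℕ} (M B : ℕ) → Config N P → List (IOStep N P) → Set
ValidRun M B c [] = Data.Unit.⊤ where import Data.Unit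
ValidRun M B c (s ∷ ss) = ValidStep M B c s × ValidRun M B (applyStep c s) ss

initConfig : (N P B : ℕ) → .{{NonZero B}} → Config N P
initConfig N P B = record
  { mem = λ b → tabulate (λ i → (toℕ i / B) ≡ᵇ b)
  ; cache = λ _ → tabulate (λ _ → false) }

Solves : (n : ℕ) → Labeling n → (ℕ → Subset (2 * n)) → Set
Solves n λ' mem = (j : Fin n) → ∃ λ b → (i : Fin (2 * n)) → lookup λ' i ≡ j → i ∈ mem b

SolvableIn : (n P M B : ℕ) → .{{NonZero B}} → Labeling n → ℕ → Set
SolvableIn n P M B λ' t =
  Σ (List (IOStep (2 * n) P)) λ prog →
    length prog ≡ t × ValidRun M B (initConfig (2 * n) P B) prog
      × Solves n λ' (Config.mem (run (initConfig (2 * n) P B) prog))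

-- perm_P(N,M,B), up to constant factors, with natural-number floors:
-- d = max 2 (min ⌊M/B⌋ ⌊N/(PB)⌋),  logbar_d(N/B) = max 1 ⌊⌊log₂(N/B)⌋ / ⌊log₂ d⌋⌋.

dPar : (N M B P : ℕ) → .{{NonZero B}} → .{{NonZero P}} → ℕ
dPar N M B P = 2 ⊔ ((M / B) ⊓ ((N / (P * B)) {{m*n≢0 P B}}))

permNat : (N M B P : ℕ) → .{{NonZero B}} → .{{NonZero P}} → ℕ
permNat N M B P = (N / P) ⊓ (((N / (P * B)) {{m*n≢0 P B}}) * (1 ⊔ (lg / lgd)))
  where
  lg : ℕ
  lg = ⌊log₂ (N / B) ⌋
  lgd : ℕ
  lgd = suc (⌊log₂ (dPar N M B P) ⌋ Data.Nat.∸ 1)   -- = ⌊log₂ d⌋ ≥ 1 since d ≥ 2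

EasyFor : (c n P M B : ℕ) → .{{NonZero B}} → .{{NonZero P}} → Labeling n → Set
EasyFor c n P M B λ' = ∃ λ t → c * t < permNat (2 * n) M B P × SolvableIn n P M B λ' t

{-# OPTIONS --safe #-}

-- Among all copies of an atom only one lies on the way to its final position, so a run can be followed by keeping, for each
-- atom, the place of this essential copy. In one parallel I/O at most P B of the at most min (P M) (N + P B) essential copies
-- within reach change their place, and a processor's read address is determined by an atom of the block that is read. Hence
-- a placement has at most (N + 1)^P (d + 2)^(3 P B) successors, where d = min (M / B) (N / (P B)). A final placement with at
-- most B atoms per block solves at most n! B^n of the (2n)! / 2^n = n! (2n - 1)!! instances, and (2n - 1)!! ≥ (2n / 16)^n;
-- comparing logarithms bounds the number of steps. Where the claimed bound is smaller than the constant c only the empty run is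
-- left, and swapping the labels of two atoms from different blocks maps the solved instances injectively to unsolved ones.

module Submission where

open import Defs

import Algebra.Properties.CommutativeSemigroup as CommutativeSemigroup
open import Data.Bool using (T; true; false)
import Data.Bool.Properties as Bool
open import Data.Empty using (⊥)
open import Data.Fin using (Fin; zero; suc; toℕ; fromℕ<; punchIn; punchOut)
open import Data.Fin.Properties using (_≟_; any?; toℕ-injective; toℕ-fromℕ<; punchIn-injective; punchInᵢ≢i; punchIn-punchOut)
open import Data.Fin.Subset using (Subset; ∣_∣) renaming (_∈_ to _∈ₛ_; ⊥ to ∅)
open import Data.Fin.Subset.Properties using (p⊆q⇒∣p∣≤∣q∣; x∈p∪q⁻; ∣⊥∣≡0)
open import Data.List using (List; []; _∷_; length; filter; concatMap; map; _++_; take; allFin; cartesianProduct; upTo)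
import Data.List as List
open import Data.List.Membership.Propositional using (_∈_)
open import Data.List.Membership.Propositional.Properties
open import Data.List.Properties using (length-++; length-map; filter-++; length-take; take-all; length-tabulate; length-upTo)
open import Data.List.Relation.Unary.All using (All; []; _∷_)
import Data.List.Relation.Unary.All as All
open import Data.List.Relation.Unary.AllPairs using ([]; _∷_)
open import Data.List.Relation.Unary.Any using (here; there)
open import Data.List.Relation.Unary.Unique.Propositional using (Unique)
import Data.List.Relation.Unary.Unique.Propositional.Properties as Unique
open import Data.Maybe using (Maybe; just; nothing)
import Data.Maybe.Properties as Maybe
open import Data.Nat hiding (_≟_)
open import Data.Nat.DivMod
  using (m≡m%n+[m/n]*n; m%n<n; m/n*n≤m; m/n≤m; m*n/n≡m; n/n≡1; 0/n≡0; /-monoʳ-≤; /-monoˡ-≤)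
open import Data.Nat.Induction using (<-rec)
open import Data.Nat.Logarithm
open import Data.Nat.Properties hiding (_≟_)
import Data.Nat.Properties as ℕ
open import Data.Nat.Tactic.RingSolver using (solve-∀)
open import Data.Product using (Σ; ∃; _×_; _,_; proj₁; proj₂)
import Data.Product.Properties as Product
open import Data.Sum using (_⊎_; inj₁; inj₂)
import Data.Sum.Properties as Sum
open import Data.Vec using (Vec; []; _∷_; lookup; count; insertAt; removeAt; _[_]≔_)
import Data.Vec as Vec
open import Data.Vec.Properties
  using ( lookup-map; lookup∘tabulate; tabulate-∘; tabulate∘lookup; tabulate-cong; []=⇒lookup; lookup⇒[]=
        ; insertAt-lookup; insertAt-punchIn; insertAt-removeAt; removeAt-insertAt
        ; lookup∘update; lookup∘update′; []≔-idempotent; []≔-lookup )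
import Data.Vec.Relation.Unary.All.Properties as AllV
open import Function using (_∘_; id; case_of_)
open import Relation.Binary.Definitions using (DecidableEquality)
open import Relation.Binary.PropositionalEquality
open import Relation.Nullary using (¬_; Dec; yes; no; contradiction)
open import Relation.Nullary.Decidable using (toWitness)
open import Relation.Unary using (Decidable)

-- Counting reachable memory contents directly meets two obstacles: the shared memory is unbounded,
-- so there are infinitely many addresses to write to, and atoms may be copied freely. Copies are
-- handled backwards in time: for each atom a final block containing it is fixed, and every step is
-- asked where that copy came from, which leaves one place per atom at any time. Write addresses are
-- forgotten: a block is named by the step and the processor that last wrote it, so a write involves
-- no choice of address. Nothing is lost, since a labeling is only tested for whether equal labels
-- lie at equal places, and this survives every injective renaming of blocks. A read still costs
-- about log N bits for the atom that names its block. This can exceed the cost B log d of the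
-- transfer itself, and then the alternative N / P in the minimum pays for it. The factor n! for
-- naming the pairs occurs both in the number of instances and in the bound for one placement; it
-- cancels, and B^n remains to be compared with (2n - 1)!!.

private variable
  A C : Set
  m n : ℕ

-- Lists, counting and the number of short sublists

∈-++-insert : ∀ {x y : A} ys {zs} → x ∈ (ys ++ y ∷ zs) → x ≢ y → x ∈ (ys ++ zs)
∈-++-insert ys x∈ x≢y with ∈-++⁻ ys x∈
... | inj₁ x∈ys          = ∈-++⁺ˡ x∈ys
... | inj₂ (here x≡y)    = contradiction x≡y x≢y
... | inj₂ (there x∈zs)  = ∈-++⁺ʳ ys x∈zs

unique-⊆⇒length≤ : {xs ys : List A} → Unique xs → (∀ {x} → x ∈ xs → x ∈ ys) → length xs ≤ length ys
unique-⊆⇒length≤ {xs = []} _ _ = z≤n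
unique-⊆⇒length≤ {xs = x ∷ xs} (x∉ ∷ u) sub with ∈-∃++ (sub (here refl))
... | ys , zs , refl = begin
  suc (length xs)              ≤⟨ s≤s (unique-⊆⇒length≤ u λ w∈ → ∈-++-insert ys (sub (there w∈)) (λ { refl → All.lookup x∉ w∈ refl })) ⟩
  suc (length (ys ++ zs))      ≡⟨ cong suc (length-++ ys) ⟩
  suc (length ys + length zs)  ≡⟨ +-suc (length ys) (length zs) ⟨
  length ys + suc (length zs)  ≡⟨ length-++ ys ⟨
  length (ys ++ x ∷ zs)        ∎
  where open ≤-Reasoning

length-concatMap-≤ : ∀ (f : A → List C) k xs → (∀ x → length (f x) ≤ k) → length (concatMap f xs) ≤ length xs * k
length-concatMap-≤ f k [] b = z≤n
length-concatMap-≤ f k (x ∷ xs) b = begin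
  length (f x ++ concatMap f xs)         ≡⟨ length-++ (f x) ⟩
  length (f x) + length (concatMap f xs) ≤⟨ +-mono-≤ (b x) (length-concatMap-≤ f k xs b) ⟩
  k + length xs * k                      ∎
  where open ≤-Reasoning

∈-concatMap : ∀ (f : A → List C) {x y xs} → x ∈ xs → y ∈ f x → y ∈ concatMap f xs
∈-concatMap f {xs = x ∷ xs} (here refl) y∈ = ∈-++⁺ˡ y∈
∈-concatMap f {xs = x ∷ xs} (there x∈) y∈ = ∈-++⁺ʳ (f x) (∈-concatMap f x∈ y∈)

length-allVecs : ∀ k m → length (allVecs k m) ≤ k ^ m
length-allVecs k zero = ≤-refl
length-allVecs k (suc m) = begin
  length (concatMap (λ x → map (x ∷_) (allVecs k m)) (allFin k))
    ≤⟨ length-concatMap-≤ _ (k ^ m) (allFin k) (λ x → ≤-trans (≤-reflexive (length-map _ (allVecs k m))) (length-allVecs k m)) ⟩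
  length (allFin k) * k ^ m ≡⟨ cong (_* k ^ m) (length-tabulate {n = k} id) ⟩
  k * k ^ m ∎
  where open ≤-Reasoning

∈-allVecs : ∀ {k m} (v : Vec (Fin k) m) → v ∈ allVecs k m
∈-allVecs [] = here refl
∈-allVecs (x ∷ v) = ∈-concatMap (λ y → map (y ∷_) (allVecs _ _)) (∈-allFin x) (∈-map⁺ (x ∷_) (∈-allVecs v))

count-mono : ∀ {P : A → Set} {Q : C → Set} (P? : Decidable P) (Q? : Decidable Q) {n} (xs : Vec A n) (ys : Vec C n) →
  (∀ i → P (lookup xs i) → Q (lookup ys i)) → count P? xs ≤ count Q? ys
count-mono P? Q? [] [] f = z≤n
count-mono P? Q? (x ∷ xs) (y ∷ ys) f with P? x | Q? y
... | yes p | yes q = s≤s (count-mono P? Q? xs ys (f ∘ suc))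
... | yes p | no ¬q = contradiction (f zero p) ¬q
... | no ¬p | yes q = m≤n⇒m≤1+n (count-mono P? Q? xs ys (f ∘ suc))
... | no ¬p | no ¬q = count-mono P? Q? xs ys (f ∘ suc)

length-filter-tabulate-≤ : ∀ {P : A → Set} {Q : C → Set} (P? : Decidable P) (Q? : Decidable Q) {n} (f : Fin n → A) (v : Vec C n) →
  (∀ i → P (f i) → Q (lookup v i)) → length (filter P? (List.tabulate f)) ≤ count Q? v
length-filter-tabulate-≤ P? Q? f [] h = z≤n
length-filter-tabulate-≤ P? Q? f (y ∷ v) h with P? (f zero) | Q? y
... | yes p | yes q = s≤s (length-filter-tabulate-≤ P? Q? (f ∘ suc) v (h ∘ suc))
... | yes p | no ¬q = contradiction (h zero p) ¬q
... | no ¬p | yes q = m≤n⇒m≤1+n (length-filter-tabulate-≤ P? Q? (f ∘ suc) v (h ∘ suc))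
... | no ¬p | no ¬q = length-filter-tabulate-≤ P? Q? (f ∘ suc) v (h ∘ suc)

count-≤-length-filter-tabulate : ∀ {P : A → Set} {Q : C → Set} (P? : Decidable P) (Q? : Decidable Q) {n} (f : Fin n → A) (v : Vec C n) →
  (∀ i → Q (lookup v i) → P (f i)) → count Q? v ≤ length (filter P? (List.tabulate f))
count-≤-length-filter-tabulate P? Q? f [] h = z≤n
count-≤-length-filter-tabulate P? Q? f (y ∷ v) h with P? (f zero) | Q? y
... | yes p | yes q = s≤s (count-≤-length-filter-tabulate P? Q? (f ∘ suc) v (h ∘ suc))
... | no ¬p | yes q = contradiction (h zero q) ¬p
... | yes p | no ¬q = m≤n⇒m≤1+n (count-≤-length-filter-tabulate P? Q? (f ∘ suc) v (h ∘ suc))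
... | no ¬p | no ¬q = count-≤-length-filter-tabulate P? Q? (f ∘ suc) v (h ∘ suc)

length-filter-mono : ∀ {P Q : A → Set} (P? : Decidable P) (Q? : Decidable Q) xs → (∀ {x} → x ∈ xs → P x → Q x) →
  length (filter P? xs) ≤ length (filter Q? xs)
length-filter-mono P? Q? [] h = z≤n
length-filter-mono P? Q? (x ∷ xs) h with P? x | Q? x
... | yes p | yes q = s≤s (length-filter-mono P? Q? xs (h ∘ there))
... | yes p | no ¬q = contradiction (h (here refl) p) ¬q
... | no ¬p | yes q = m≤n⇒m≤1+n (length-filter-mono P? Q? xs (h ∘ there))
... | no ¬p | no ¬q = length-filter-mono P? Q? xs (h ∘ there)

length-filter-⊎ : ∀ {P Q R : A → Set} (P? : Decidable P) (Q? : Decidable Q) (R? : Decidable R) xs →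
  (∀ x → P x → Q x ⊎ R x) → length (filter P? xs) ≤ length (filter Q? xs) + length (filter R? xs)
length-filter-⊎ P? Q? R? [] h = z≤n
length-filter-⊎ P? Q? R? (x ∷ xs) h with ih ← length-filter-⊎ P? Q? R? xs h | P? x | Q? x | R? x
... | yes p | yes q | yes r = s≤s (≤-trans ih (+-monoʳ-≤ _ (n≤1+n _)))
... | yes p | yes q | no ¬r = s≤s ih
... | yes p | no ¬q | yes r = ≤-trans (s≤s ih) (≤-reflexive (sym (+-suc _ _)))
... | yes p | no ¬q | no ¬r with h x p
...    | inj₁ q = contradiction q ¬q
...    | inj₂ r = contradiction r ¬r
length-filter-⊎ P? Q? R? (x ∷ xs) h | no ¬p | yes q | yes r = m≤n⇒m≤1+n (≤-trans ih (+-monoʳ-≤ _ (n≤1+n _)))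
length-filter-⊎ P? Q? R? (x ∷ xs) h | no ¬p | yes q | no ¬r = m≤n⇒m≤1+n ih
length-filter-⊎ P? Q? R? (x ∷ xs) h | no ¬p | no ¬q | yes r = ≤-trans ih (+-monoʳ-≤ _ (n≤1+n _))
length-filter-⊎ P? Q? R? (x ∷ xs) h | no ¬p | no ¬q | no ¬r = ih

length-filter-map : ∀ {P : C → Set} (P? : Decidable P) (f : A → C) xs → length (filter P? (map f xs)) ≡ length (filter (P? ∘ f) xs)
length-filter-map P? f [] = refl
length-filter-map P? f (x ∷ xs) with P? (f x)
... | yes _ = cong suc (length-filter-map P? f xs)
... | no _ = length-filter-map P? f xs

length-filter-cartesianProduct : ∀ {P : (A × C) → Set} (P? : Decidable P) k xs ys →
  (∀ x → length (filter (λ y → P? (x , y)) ys) ≤ k) → length (filter P? (cartesianProduct xs ys)) ≤ length xs * k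
length-filter-cartesianProduct P? k [] ys b = z≤n
length-filter-cartesianProduct P? k (x ∷ xs) ys b = begin
  length (filter P? (map (x ,_) ys ++ cartesianProduct xs ys))                         ≡⟨ cong length (filter-++ P? (map (x ,_) ys) _) ⟩
  length (filter P? (map (x ,_) ys) ++ filter P? (cartesianProduct xs ys))             ≡⟨ length-++ (filter P? (map (x ,_) ys)) ⟩
  length (filter P? (map (x ,_) ys)) + length (filter P? (cartesianProduct xs ys))
    ≡⟨ cong (_+ length (filter P? (cartesianProduct xs ys))) (length-filter-map P? (x ,_) ys) ⟩
  length (filter (λ y → P? (x , y)) ys) + length (filter P? (cartesianProduct xs ys))
    ≤⟨ +-mono-≤ (b x) (length-filter-cartesianProduct P? k xs ys b) ⟩
  k + length xs * k ∎
  where open ≤-Reasoning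

subs : ℕ → List A → List (List A)
subs k       []       = [] ∷ []
subs zero    (x ∷ xs) = subs zero xs
subs (suc k) (x ∷ xs) = subs (suc k) xs ++ map (x ∷_) (subs k xs)

∈-subs : ∀ {P : A → Set} (P? : Decidable P) k xs → length (filter P? xs) ≤ k → filter P? xs ∈ subs k xs
∈-subs P? zero [] b = here refl
∈-subs P? (suc k) [] b = here refl
∈-subs P? zero (x ∷ xs) b with P? x
... | no _ = ∈-subs P? zero xs b
∈-subs P? (suc k) (x ∷ xs) b with P? x
... | no _ = ∈-++⁺ˡ (∈-subs P? (suc k) xs b)
... | yes _ = ∈-++⁺ʳ (subs (suc k) xs) (∈-map⁺ (x ∷_) (∈-subs P? k xs (s≤s⁻¹ b)))

length-subs-[] : ∀ k → length (subs {A} k []) ≡ 1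
length-subs-[] zero = refl
length-subs-[] (suc k) = refl

-- A sum of binomial coefficients, estimated by a code: along `xs`, every chosen element and every
-- completed run of `D` skipped elements ends a symbol, and a symbol takes `D + 1` values. `g` is
-- the number of elements left in the current run, so `suc g` counts the values still open for the
-- current symbol.
length-subs-gap : ∀ D k j g (xs : List A) → g ≤ D → length xs ≤ g + j * D → length (subs k xs) ≤ suc g * suc D ^ (k + j)
length-subs-gap {A = A} D k j g [] g≤ b = ≤-trans (≤-reflexive (length-subs-[] {A} k))
  (*-mono-≤ {1} {suc g} (s≤s z≤n) (m^n>0 (suc D) (k + j)))
length-subs-gap D k (suc j) zero xs@(_ ∷ _) g≤ b = begin
  length (subs k xs) ≤⟨ length-subs-gap D k j D xs ≤-refl b ⟩
  suc D * suc D ^ (k + j) ≡⟨⟩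
  suc D ^ suc (k + j) ≡⟨ cong (suc D ^_) (+-suc k j) ⟨
  suc D ^ (k + suc j) ≡⟨ *-identityˡ _ ⟨
  1 * suc D ^ (k + suc j) ∎
  where open ≤-Reasoning
length-subs-gap D zero j (suc g) (x ∷ xs) g≤ b = begin
  length (subs zero xs) ≤⟨ length-subs-gap D zero j g xs (≤-trans (n≤1+n g) g≤) (s≤s⁻¹ b) ⟩
  suc g * suc D ^ j ≤⟨ *-monoˡ-≤ (suc D ^ j) (n≤1+n (suc g)) ⟩
  suc (suc g) * suc D ^ j ∎
  where open ≤-Reasoning
length-subs-gap D (suc k) j (suc g) (x ∷ xs) g≤ b = begin
  length (subs (suc k) xs ++ map (x ∷_) (subs k xs))          ≡⟨ length-++ (subs (suc k) xs) ⟩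
  length (subs (suc k) xs) + length (map (x ∷_) (subs k xs))  ≡⟨ cong (length (subs (suc k) xs) +_) (length-map _ (subs k xs)) ⟩
  length (subs (suc k) xs) + length (subs k xs)               ≤⟨ +-mono-≤ (length-subs-gap D (suc k) j g xs g≤D (s≤s⁻¹ b)) step ⟩
  suc g * suc D ^ (suc k + j) + suc D ^ (suc k + j)           ≡⟨ +-comm _ (suc D ^ (suc k + j)) ⟩
  suc (suc g) * suc D ^ (suc k + j)                           ∎
  where
  open ≤-Reasoning
  g≤D = ≤-trans (n≤1+n g) g≤
  step : length (subs k xs) ≤ suc D ^ (suc k + j)
  -- Choosing `x` ends the symbol and opens a new one, so the gap is reset to the full `D`.
  step = length-subs-gap D k j D xs ≤-refl (≤-trans (s≤s⁻¹ b) (+-monoˡ-≤ (j * D) g≤D))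

length-subs : ∀ D k j (xs : List A) → length xs ≤ j * D → length (subs k xs) ≤ suc D ^ (k + j)
length-subs D k j xs b = ≤-trans (length-subs-gap D k j 0 xs z≤n b) (≤-reflexive (*-identityˡ _))

-- Labelings

module _ {P : A → Set} (P? : Decidable P) where

  count-∷-yes : ∀ {x} (xs : Vec A n) → P x → count P? (x ∷ xs) ≡ suc (count P? xs)
  count-∷-yes {x = x} xs p with P? x
  ... | yes _ = refl
  ... | no ¬p = contradiction p ¬p

  count-∷-no : ∀ {x} (xs : Vec A n) → ¬ P x → count P? (x ∷ xs) ≡ count P? xs
  count-∷-no {x = x} xs ¬p with P? x
  ... | yes p = contradiction p ¬p
  ... | no _  = refl

  count-∷-cong : ∀ x (xs : Vec A m) (ys : Vec A n) → count P? xs ≡ count P? ys → count P? (x ∷ xs) ≡ count P? (x ∷ ys)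
  count-∷-cong x xs ys eq with P? x
  ... | yes _ = cong suc eq
  ... | no _  = eq

  count-∷-≤ : ∀ x (xs : Vec A n) → count P? xs ≤ count P? (x ∷ xs)
  count-∷-≤ x xs with P? x
  ... | yes _ = n≤1+n _
  ... | no _  = ≤-refl

  count-swap : ∀ x y (xs : Vec A n) → count P? (x ∷ y ∷ xs) ≡ count P? (y ∷ x ∷ xs)
  count-swap x y xs with P? x | P? y
  ... | yes _ | yes _ = refl
  ... | yes _ | no _  = refl
  ... | no _  | yes _ = refl
  ... | no _  | no _  = refl

  count-insertAt : ∀ (xs : Vec A n) q y → count P? (insertAt xs q y) ≡ count P? (y ∷ xs)
  count-insertAt xs zero y = refl
  count-insertAt (x ∷ xs) (suc q) y = trans (count-∷-cong x (insertAt xs q y) (y ∷ xs) (count-insertAt xs q y)) (count-swap x y xs)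

  count-none : ∀ (xs : Vec A n) → (∀ i → ¬ P (lookup xs i)) → count P? xs ≡ 0
  count-none [] h = refl
  count-none (x ∷ xs) h = trans (count-∷-no xs (h zero)) (count-none xs (h ∘ suc))

  count≡0⇒none : ∀ (xs : Vec A n) → count P? xs ≡ 0 → ∀ i → ¬ P (lookup xs i)
  count≡0⇒none (x ∷ xs) eq i with P? x
  count≡0⇒none (x ∷ xs) eq zero | no ¬p = ¬p
  count≡0⇒none (x ∷ xs) eq (suc i) | no ¬p = count≡0⇒none xs eq i

  count>0⇒some : ∀ (xs : Vec A n) → 0 < count P? xs → ∃ λ i → P (lookup xs i)
  count>0⇒some (x ∷ xs) lt with P? x
  ... | yes p = zero , p
  ... | no _ with i , p ← count>0⇒some xs lt = suc i , p

-- The recursion behind both bounds on the number of instances: the first atom has label j, its partner sits at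
-- position q, and the remaining labels form an instance with one label less.
extend : Fin (suc n) → Fin (suc m) → Vec (Fin n) m → Vec (Fin (suc n)) (suc (suc m))
extend j q v = j ∷ insertAt (Vec.map (punchIn j) v) q j

Valid : Vec (Fin n) m → Set
Valid v = ∀ j → count (_≟ j) v ≡ 2

count-map-punchIn : ∀ (j : Fin (suc n)) i (v : Vec (Fin n) m) → count (_≟ punchIn j i) (Vec.map (punchIn j) v) ≡ count (_≟ i) v
count-map-punchIn j i v = ≤-antisym
  (count-mono _ _ (Vec.map (punchIn j) v) v λ k eq → punchIn-injective j _ _ (trans (sym (lookup-map k (punchIn j) v)) eq))
  (count-mono _ _ v (Vec.map (punchIn j) v) λ k eq → trans (lookup-map k (punchIn j) v) (cong (punchIn j) eq))

count-map-punchIn-self : ∀ (j : Fin (suc n)) (v : Vec (Fin n) m) → count (_≟ j) (Vec.map (punchIn j) v) ≡ 0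
count-map-punchIn-self j v = count-none _ (Vec.map (punchIn j) v) λ k eq → punchInᵢ≢i j _ (trans (sym (lookup-map k (punchIn j) v)) eq)

count-extend : ∀ (j : Fin (suc n)) i (q : Fin (suc m)) (v : Vec (Fin n) m) → count (_≟ punchIn j i) (extend j q v) ≡ count (_≟ i) v
count-extend j i q v = begin
  count (_≟ punchIn j i) (extend j q v)
    ≡⟨ count-∷-no (_≟ punchIn j i) (insertAt (Vec.map (punchIn j) v) q j) j≢ ⟩
  count (_≟ punchIn j i) (insertAt (Vec.map (punchIn j) v) q j)   ≡⟨ count-insertAt (_≟ punchIn j i) (Vec.map (punchIn j) v) q j ⟩
  count (_≟ punchIn j i) (j ∷ Vec.map (punchIn j) v)              ≡⟨ count-∷-no (_≟ punchIn j i) (Vec.map (punchIn j) v) j≢ ⟩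
  count (_≟ punchIn j i) (Vec.map (punchIn j) v)                  ≡⟨ count-map-punchIn j i v ⟩
  count (_≟ i) v                                                         ∎
  where
  open ≡-Reasoning
  j≢ : j ≢ punchIn j i
  j≢ = punchInᵢ≢i j i ∘ sym

count-extend-self : ∀ (j : Fin (suc n)) (q : Fin (suc m)) (v : Vec (Fin n) m) → count (_≟ j) (extend j q v) ≡ 2
count-extend-self j q v = begin
  count (_≟ j) (extend j q v)                                 ≡⟨ count-∷-yes (_≟ j) (insertAt (Vec.map (punchIn j) v) q j) refl ⟩
  suc (count (_≟ j) (insertAt (Vec.map (punchIn j) v) q j))   ≡⟨ cong suc (count-insertAt (_≟ j) (Vec.map (punchIn j) v) q j) ⟩
  suc (count (_≟ j) (j ∷ Vec.map (punchIn j) v))              ≡⟨ cong suc (count-∷-yes (_≟ j) (Vec.map (punchIn j) v) refl) ⟩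
  suc (suc (count (_≟ j) (Vec.map (punchIn j) v)))            ≡⟨ cong (λ z → suc (suc z)) (count-map-punchIn-self j v) ⟩
  2                                                           ∎
  where open ≡-Reasoning

valid-extend : ∀ (j : Fin (suc n)) (q : Fin (suc m)) (v : Vec (Fin n) m) → Valid v → Valid (extend j q v)
valid-extend j q v val i = case j ≟ i of λ where
  (yes refl) → count-extend-self j q v
  (no j≢i) → subst (λ k → count (_≟ k) (extend j q v) ≡ 2) (punchIn-punchOut j≢i) (trans (count-extend j (punchOut j≢i) q v)
        (val (punchOut j≢i)))

-- Were the positions different, the `j` inserted at `p` would have to be an entry of `ys`.
insertAt-injective-position : ∀ {j : A} (xs ys : Vec A n) p q → (∀ i → lookup ys i ≢ j) → insertAt xs p j ≡ insertAt ys q j → p ≡ q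
insertAt-injective-position {j = j} xs ys p q h eq with p ≟ q
... | yes p≡q = p≡q
... | no p≢q = contradiction at-p (h (punchOut (p≢q ∘ sym)))
  where
  at-p : lookup ys (punchOut (p≢q ∘ sym)) ≡ j
  at-p = begin
    lookup ys (punchOut (p≢q ∘ sym))                                     ≡⟨ insertAt-punchIn ys q j _ ⟨
    lookup (insertAt ys q j) (punchIn q (punchOut (p≢q ∘ sym)))   ≡⟨ cong₂ lookup (sym eq) (punchIn-punchOut (p≢q ∘ sym)) ⟩
    lookup (insertAt xs p j) p                                           ≡⟨ insertAt-lookup xs p j ⟩
    j                                                                    ∎
    where open ≡-Reasoning

map-punchIn-injective : ∀ (j : Fin (suc n)) (v w : Vec (Fin n) m) → Vec.map (punchIn j) v ≡ Vec.map (punchIn j) w → v ≡ w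
map-punchIn-injective j [] [] eq = refl
map-punchIn-injective j (x ∷ v) (y ∷ w) eq =
  cong₂ _∷_ (punchIn-injective j x y (cong Vec.head eq)) (map-punchIn-injective j v w (cong Vec.tail eq))

extend-injective : ∀ {j j' : Fin (suc n)} {q q' : Fin (suc m)} {v v' : Vec (Fin n) m} → extend j q v ≡ extend j' q' v' →
  (j , q , v) ≡ (j' , q' , v')
extend-injective {j = j} {q = q} {q'} {v} {v'} eq with refl ← cong Vec.head eq
  with refl ← insertAt-injective-position (Vec.map (punchIn j) v) (Vec.map (punchIn j) v') q q'
                (λ i e → punchInᵢ≢i j _ (trans (sym (lookup-map i (punchIn j) v')) e)) (cong Vec.tail eq)
  = cong (λ w → j , q , w) (map-punchIn-injective j v v' (begin
      Vec.map (punchIn j) v                                    ≡⟨ removeAt-insertAt _ q j ⟨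
      removeAt (insertAt (Vec.map (punchIn j) v) q j) q        ≡⟨ cong (λ w → removeAt w q) (cong Vec.tail eq) ⟩
      removeAt (insertAt (Vec.map (punchIn j) v') q j) q       ≡⟨ removeAt-insertAt _ q j ⟩
      Vec.map (punchIn j) v'                                   ∎))
  where open ≡-Reasoning

-- Validity puts exactly one further `j` into the tail. Once it is removed, no entry equals `j`,
-- which is what `punchOut` needs to close the gap in the labels.
valid⇒extend : ∀ (v : Vec (Fin (suc n)) (suc (suc m))) → Valid v → ∃ λ j → ∃ λ q → ∃ λ v' → v ≡ extend j q v' × Valid v'
valid⇒extend {n} {m} (j ∷ μ) val = j , q , v' , v≡ , λ i → trans (sym (count-extend j i q v'))
  (trans (cong (count (_≟ punchIn j i)) (sym v≡)) (val (punchIn j i)))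
  where
  open ≡-Reasoning
  one : count (_≟ j) μ ≡ 1
  one = suc-injective (trans (sym (count-∷-yes (_≟ j) μ refl)) (val j))
  partner = count>0⇒some (_≟ j) μ (≤-reflexive (sym one))
  q = proj₁ partner
  ν = removeAt μ q
  μ≡ : insertAt ν q j ≡ μ
  μ≡ = trans (cong (insertAt ν q) (sym (proj₂ partner))) (insertAt-removeAt μ q)
  ν-zero : count (_≟ j) ν ≡ 0
  ν-zero = suc-injective (begin
    suc (count (_≟ j) ν)             ≡⟨ count-∷-yes (_≟ j) ν refl ⟨
    count (_≟ j) (j ∷ ν)             ≡⟨ count-insertAt (_≟ j) ν q j ⟨
    count (_≟ j) (insertAt ν q j)    ≡⟨ cong (count (_≟ j)) μ≡ ⟩
    count (_≟ j) μ                   ≡⟨ one ⟩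
    1                                ∎)
  v' : Vec (Fin n) m
  v' = Vec.tabulate λ i → punchOut {i = j} {j = lookup ν i} (count≡0⇒none (_≟ j) ν ν-zero i ∘ sym)
  v≡ : j ∷ μ ≡ extend j q v'
  v≡ = cong (j ∷_) (begin
    μ                                       ≡⟨ μ≡ ⟨
    insertAt ν q j                          ≡⟨ cong (λ w → insertAt w q j) (tabulate∘lookup ν) ⟨
    insertAt (Vec.tabulate (lookup ν)) q j  ≡⟨ cong (λ w → insertAt w q j) (tabulate-cong λ i → punchIn-punchOut {i = j} _) ⟨
    insertAt (Vec.tabulate _) q j           ≡⟨ cong (λ w → insertAt w q j) (tabulate-∘ (punchIn j) _) ⟩
    insertAt (Vec.map (punchIn j) v') q j   ∎)

-- Instances solved by a fixed placement

module Compatible {X : Set} (_≟X_ : DecidableEquality X) (B : ℕ) where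

  -- Only equality of places matters, hence the arbitrary type `X`. `take B` makes the bound on the
  -- length hold for every `β`; it drops nothing when no place contains more than `B` atoms.
  compatible : ∀ n m → Vec X m → List (Vec (Fin n) m)
  compatible zero zero [] = [] ∷ []
  compatible (suc n) (suc (suc m)) (x ∷ β) =
    concatMap (λ j → concatMap (λ q → map (extend j q) (compatible n m (removeAt β q)))
                       (take B (filter (λ q → lookup β q ≟X x) (allFin (suc m)))))
              (allFin (suc n))
  compatible _ _ _ = []

  length-compatible : ∀ n m (β : Vec X m) → length (compatible n m β) ≤ n ! * B ^ n
  length-compatible zero zero [] = ≤-refl
  length-compatible zero (suc m) β = z≤n
  length-compatible (suc n) zero β = z≤n
  length-compatible (suc n) (suc zero) β = z≤n
  length-compatible (suc n) (suc (suc m)) (x ∷ β) = begin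
    length (compatible (suc n) (suc (suc m)) (x ∷ β))
      ≤⟨ length-concatMap-≤ (λ j → concatMap (λ q → map (extend j q) (compatible n m (removeAt β q))) (take B positions)) (B *
          (n ! * B ^ n)) (allFin (suc n)) per-label ⟩
    length (allFin (suc n)) * (B * (n ! * B ^ n))          ≡⟨ cong (_* (B * (n ! * B ^ n))) (length-tabulate {n = suc n} id) ⟩
    suc n * (B * (n ! * B ^ n))                            ≡⟨ cong (suc n *_) (*-comm B (n ! * B ^ n)) ⟩
    suc n * (n ! * B ^ n * B)                              ≡⟨ cong (suc n *_) (*-assoc (n !) (B ^ n) B) ⟩
    suc n * (n ! * (B ^ n * B))                            ≡⟨ cong (λ z → suc n * (n ! * z)) (*-comm (B ^ n) B) ⟩
    suc n * (n ! * B ^ suc n)                              ≡⟨ *-assoc (suc n) (n !) (B ^ suc n) ⟨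
    suc n ! * B ^ suc n                                    ∎
    where
    open ≤-Reasoning
    positions = filter (λ q → lookup β q ≟X x) (allFin (suc m))
    per-label : ∀ j → length (concatMap (λ q → map (extend j q) (compatible n m (removeAt β q))) (take B positions)) ≤ B * (n ! * B ^ n)
    per-label j = begin
      _                                             ≤⟨ length-concatMap-≤ _ (n ! * B ^ n) (take B positions)
                                                       (λ q → ≤-trans (≤-reflexive (length-map (extend j q) (compatible n m
                                                             (removeAt β q)))) (length-compatible n m (removeAt β q))) ⟩
      length (take B positions) * (n ! * B ^ n)
        ≤⟨ *-monoˡ-≤ (n ! * B ^ n) (≤-trans (≤-reflexive (length-take B positions)) (m⊓n≤m B _)) ⟩
      B * (n ! * B ^ n)                             ∎

  ∈-compatible : ∀ n m (β : Vec X m) (v : Vec (Fin n) m) → Valid v →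
    (∀ i i' → lookup v i ≡ lookup v i' → lookup β i ≡ lookup β i') →
    (∀ i → count (_≟X lookup β i) β ≤ B) →
    v ∈ compatible n m β
  ∈-compatible zero zero [] [] val comp small = here refl
  ∈-compatible zero (suc m) β (() ∷ v) val comp small
  ∈-compatible (suc n) zero β [] val comp small = contradiction (val zero) λ ()
  ∈-compatible (suc n) (suc zero) β (j ∷ []) val comp small =
    contradiction (trans (sym (count-∷-yes (_≟ j) [] refl)) (val j)) λ ()
  ∈-compatible (suc n) (suc (suc m)) (x ∷ β) v val comp small with valid⇒extend v val
  ... | j , q , v' , refl , val' =
    ∈-concatMap _ (∈-allFin j) (∈-concatMap _ q∈ (∈-map⁺ (extend j q) (∈-compatible n m (removeAt β q) v' val' comp' small')))
    where
    γ = removeAt β q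
    lookup-γ : ∀ i → lookup β (punchIn q i) ≡ lookup γ i
    lookup-γ i = trans (cong (λ w → lookup w (punchIn q i)) (sym (insertAt-removeAt β q))) (insertAt-punchIn γ q (lookup β q) i)
    lookup-v : ∀ i → lookup (extend j q v') (suc (punchIn q i)) ≡ punchIn j (lookup v' i)
    lookup-v i = trans (insertAt-punchIn (Vec.map (punchIn j) v') q j i) (lookup-map i (punchIn j) v')
    comp' : ∀ i i' → lookup v' i ≡ lookup v' i' → lookup γ i ≡ lookup γ i'
    comp' i i' eq = trans (sym (lookup-γ i)) (trans (comp (suc (punchIn q i)) (suc (punchIn q i'))
      (trans (lookup-v i) (trans (cong (punchIn j) eq) (sym (lookup-v i'))))) (lookup-γ i'))
    small' : ∀ i → count (_≟X lookup γ i) γ ≤ B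
    small' i = begin
      count (_≟X y) γ                                ≤⟨ count-∷-≤ (_≟X y) (lookup β q) γ ⟩
      count (_≟X y) (lookup β q ∷ γ)                 ≡⟨ count-insertAt (_≟X y) γ q (lookup β q) ⟨
      count (_≟X y) (insertAt γ q (lookup β q))      ≡⟨ cong (count (_≟X y)) (insertAt-removeAt β q) ⟩
      count (_≟X y) β                                ≤⟨ count-∷-≤ (_≟X y) x β ⟩
      count (_≟X y) (x ∷ β)                          ≤⟨ subst (λ z → count (_≟X z) (x ∷ β) ≤ B) (lookup-γ i) (small (suc (punchIn q i))) ⟩
      B                                              ∎
      where
      open ≤-Reasoning
      y = lookup γ i
    positions = filter (λ q' → lookup β q' ≟X x) (allFin (suc m))
    few : length positions ≤ B
    few = ≤-trans (length-filter-tabulate-≤ (λ q' → lookup β q' ≟X x) (_≟X x) id β (λ _ e → e)) (≤-trans (count-∷-≤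
          (_≟X x) x β) (small zero))
    q∈ : q ∈ take B positions
    q∈ = subst (q ∈_) (sym (take-all B positions few)) (∈-filter⁺ (λ q' → lookup β q' ≟X x) (∈-allFin q)
           (sym (comp zero (suc q) (sym (insertAt-lookup (Vec.map (punchIn j) v') q j)))))

-- A lower bound for the number of instances

unique-valid⇒length≤numInstances : ∀ n (L : List (Labeling n)) → Unique L → All (ValidLabeling n) L → length L ≤ numInstances n
unique-valid⇒length≤numInstances n L u val = unique-⊆⇒length≤ u λ {v} v∈ →
  ∈-filter⁺ (validLabeling? n) (∈-allVecs v) (AllV.tabulate⁺ (All.lookup val v∈))

-- Unlike `2 * suc n`, this reduces to two successors, as the lengths in `extend` demand.
double : ℕ → ℕ
double zero = zero
double (suc n) = suc (suc (double n))

-- The double factorial (2n - 1)!!, which is the number of perfect matchings of 2n atoms.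
oddFactorial : ℕ → ℕ
oddFactorial zero = 1
oddFactorial (suc n) = suc (double n) * oddFactorial n

allInstances : ∀ n → List (Vec (Fin n) (double n))
allInstances zero = [] ∷ []
allInstances (suc n) = map (λ (j , q , v) → extend j q v)
  (cartesianProduct (allFin (suc n)) (cartesianProduct (allFin (suc (double n))) (allInstances n)))

length-cartesianProduct : ∀ {A C : Set} (xs : List A) (ys : List C) → length (cartesianProduct xs ys) ≡ length xs * length ys
length-cartesianProduct [] ys = refl
length-cartesianProduct (x ∷ xs) ys = trans (length-++ (map (x ,_) ys)) (cong₂ _+_ (length-map (x ,_) ys) (length-cartesianProduct xs ys))

allInstances-unique : ∀ n → Unique (allInstances n)
allInstances-unique zero = [] ∷ []
allInstances-unique (suc n) = Unique.map⁺ extend-injective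
  (Unique.cartesianProduct⁺ (Unique.allFin⁺ (suc n)) (Unique.cartesianProduct⁺ (Unique.allFin⁺ (suc (double n))) (allInstances-unique n)))

allInstances-valid : ∀ n {v} → v ∈ allInstances n → Valid v
allInstances-valid zero v∈ ()
allInstances-valid (suc n) v∈ with ∈-map⁻ _ v∈
... | (j , q , v) , t∈ , refl with _ , qv∈ ← ∈-cartesianProduct⁻ (allFin (suc n)) _ t∈
  with _ , v∈′ ← ∈-cartesianProduct⁻ (allFin (suc (double n))) _ qv∈ = valid-extend j q v (allInstances-valid n v∈′)

length-allInstances : ∀ n → length (allInstances n) ≡ n ! * oddFactorial n
length-allInstances zero = refl
length-allInstances (suc n) = begin
  length (allInstances (suc n))
    ≡⟨ length-map _ (cartesianProduct labels (cartesianProduct partners (allInstances n))) ⟩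
  length (cartesianProduct labels (cartesianProduct partners (allInstances n)))
    ≡⟨ length-cartesianProduct labels (cartesianProduct partners (allInstances n)) ⟩
  length labels * length (cartesianProduct partners (allInstances n))
    ≡⟨ cong₂ _*_ (length-tabulate {n = suc n} id) (length-cartesianProduct partners (allInstances n)) ⟩
  suc n * (length partners * length (allInstances n))
    ≡⟨ cong₂ (λ a b → suc n * (a * b)) (length-tabulate {n = suc (double n)} id) (length-allInstances n) ⟩
  suc n * (suc (double n) * (n ! * oddFactorial n))
    ≡⟨ cong (suc n *_) (x∙yz≈y∙xz (suc (double n)) (n !) (oddFactorial n)) ⟩
  suc n * (n ! * (suc (double n) * oddFactorial n))                     ≡⟨ *-assoc (suc n) (n !) _ ⟨
  suc n ! * oddFactorial (suc n)                                        ∎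
  where
  open ≡-Reasoning
  open CommutativeSemigroup *-commutativeSemigroup using (x∙yz≈y∙xz)
  labels = allFin (suc n)
  partners = allFin (suc (double n))

double≡2* : ∀ n → double n ≡ 2 * n
double≡2* zero = refl
double≡2* (suc n) = cong suc (trans (cong suc (double≡2* n)) (sym (+-suc n (n + 0))))

numInstances-≥ : ∀ n → n ! * oddFactorial n ≤ numInstances n
numInstances-≥ n = from (double≡2* n) (allInstances n) (allInstances-unique n) (allInstances-valid n) (length-allInstances n)
  where
  from : ∀ {m k} → m ≡ 2 * n → (L : List (Vec (Fin n) m)) → Unique L → (∀ {v} → v ∈ L → Valid v) → length L ≡ k → k ≤ numInstances n
  from refl L u val refl = unique-valid⇒length≤numInstances n L u (All.tabulate val)

-- Essential placements and their successors

module Tracing (N P B d : ℕ) where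

  -- Where the copy of an atom that is used later resides: in a cache, or in a version of a memory block. Version (0 , b) is the
  -- initial content of block b, version (suc s , p) the block written by processor p in step s.
  Place : Set
  Place = Fin P ⊎ (ℕ × ℕ)

  _≟P_ : DecidableEquality Place
  _≟P_ = Sum.≡-dec _≟_ (Product.≡-dec ℕ._≟_ ℕ._≟_)

  State : Set
  State = Vec Place N

  -- The letter zero lets a processor write, the letter suc c lets it read the block that contains atom c.
  Letters : Set
  Letters = Vec (Fin (suc N)) P

  InReach : State → Fin (suc N) → Fin P → Fin N → Set
  InReach E zero    p a = lookup E a ≡ inj₁ p
  InReach E (suc c) p a = lookup E a ≡ lookup E c

  inReach? : ∀ E α p a → Dec (InReach E α p a)
  inReach? E zero    p a = lookup E a ≟P inj₁ p
  inReach? E (suc c) p a = lookup E a ≟P lookup E c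

  Movable : State → Letters → Fin P × Fin N → Set
  Movable E α (p , a) = InReach E (lookup α p) p a

  movable? : ∀ E α → Decidable (Movable E α)
  movable? E α (p , a) = inReach? E (lookup α p) p a

  pairs : List (Fin P × Fin N)
  pairs = cartesianProduct (allFin P) (allFin N)

  movables : State → Letters → List (Fin P × Fin N)
  movables E α = filter (movable? E α) pairs

  target : ℕ → Fin P → Fin (suc N) → Place
  target s p zero    = inj₂ (suc s , toℕ p)
  target s p (suc _) = inj₁ p

  relocate : ℕ → Letters → State → List (Fin P × Fin N) → Fin N → Place
  relocate s α E [] a = lookup E a
  relocate s α E ((p , a') ∷ moves) a with a' ≟ a
  ... | yes _ = target s p (lookup α p)
  ... | no _  = relocate s α E moves a

  move : ℕ → Letters → State → List (Fin P × Fin N) → State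
  move s α E moves = Vec.tabulate (relocate s α E moves)

  nexts-with : ℕ → State → Letters → List State
  nexts-with s E α = map (move s α E) (subs (P * B) (take (P * B * 2 * suc d) (movables E α)))

  -- The movables are truncated, which affects no run, so that the number of successors is bounded for every state.
  nexts : ℕ → State → List State
  nexts s E = E ∷ concatMap (nexts-with s E) (allVecs (suc N) P)

  -- One for standing still; otherwise a letter for each processor and a choice of moves, counted by
  -- `length-subs` with `suc d` for `D`, `P * B` for `k` and `P * B * 2` for `j`.
  branching : ℕ
  branching = suc (suc N ^ P * suc (suc d) ^ (P * B + P * B * 2))

  length-nexts : ∀ s E → length (nexts s E) ≤ branching
  length-nexts s E = s≤s (≤-trans (length-concatMap-≤ (nexts-with s E) (suc (suc d) ^ (P * B + P * B * 2)) (allVecs (suc N) P) choices)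
                                  (*-monoˡ-≤ (suc (suc d) ^ (P * B + P * B * 2)) (length-allVecs (suc N) P)))
    where
    choices : ∀ α → length (nexts-with s E α) ≤ suc (suc d) ^ (P * B + P * B * 2)
    choices α = ≤-trans (≤-reflexive (length-map (move s α E) (subs (P * B) candidates)))
      (length-subs (suc d) (P * B) (P * B * 2) candidates
         (≤-trans (≤-reflexive (length-take (P * B * 2 * suc d) (movables E α))) (m⊓n≤m (P * B * 2 * suc d) _)))
      where candidates = take (P * B * 2 * suc d) (movables E α)

  reach : ℕ → ℕ → State → List State
  reach zero    s E = E ∷ []
  reach (suc T) s E = concatMap (reach T (suc s)) (nexts s E)

  length-reach : ∀ T s E → length (reach T s E) ≤ branching ^ T
  length-reach zero s E = ≤-refl
  length-reach (suc T) s E = ≤-trans (length-concatMap-≤ (reach T (suc s)) (branching ^ T) (nexts s E) (length-reach T (suc s)))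
                                     (*-monoˡ-≤ (branching ^ T) (length-nexts s E))

  -- Every state is among its own successors, so runs shorter than `T` are covered and one list
  -- serves all numbers of steps up to `T`.
  ∈-reach-stay : ∀ T s E → E ∈ reach T s E
  ∈-reach-stay zero s E = here refl
  ∈-reach-stay (suc T) s E = ∈-concatMap (reach T (suc s)) {xs = nexts s E} (here refl) (∈-reach-stay T (suc s) E)

  relocate-moved : ∀ s α E moves {p a} → (p , a) ∈ moves → (∀ {p'} → (p' , a) ∈ moves → p' ≡ p) →
    relocate s α E moves a ≡ target s p (lookup α p)
  relocate-moved s α E ((p' , a') ∷ moves) {p} {a} p∈ only with a' ≟ a
  ... | yes refl = cong (λ r → target s r (lookup α r)) (only (here refl))
  relocate-moved s α E ((p' , a') ∷ moves) (here refl) only | no a'≢a = contradiction refl a'≢a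
  relocate-moved s α E ((p' , a') ∷ moves) (there p∈) only | no a'≢a = relocate-moved s α E moves p∈ (only ∘ there)

  relocate-unmoved : ∀ s α E moves {a} → (∀ p → ¬ (p , a) ∈ moves) → relocate s α E moves a ≡ lookup E a
  relocate-unmoved s α E [] none = refl
  relocate-unmoved s α E ((p' , a') ∷ moves) {a} none with a' ≟ a
  ... | yes refl = contradiction (here refl) (none p')
  ... | no _ = relocate-unmoved s α E moves (λ p → none p ∘ there)

  -- A state gives each atom a single place, so no atom is paired with two caches.
  length-in-caches : ∀ (E : State) → length (filter (λ (p , a) → lookup E a ≟P inj₁ p) pairs) ≤ N
  length-in-caches E = begin
    length cached                               ≡⟨ length-map mark cached ⟨
    length (map mark cached)
      ≤⟨ unique-⊆⇒length≤ (Unique.map⁺ mark-injective (Unique.filter⁺ _ (Unique.cartesianProduct⁺ (Unique.allFin⁺ P)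
          (Unique.allFin⁺ N)))) marked ⟩
    length (map (λ a → lookup E a , a) (allFin N)) ≡⟨ length-map (λ a → lookup E a , a) (allFin N) ⟩
    length (allFin N)                           ≡⟨ length-tabulate {n = N} id ⟩
    N                                           ∎
    where
    open ≤-Reasoning
    mark : Fin P × Fin N → Place × Fin N
    mark (p , a) = inj₁ p , a
    mark-injective : ∀ {x y} → mark x ≡ mark y → x ≡ y
    mark-injective refl = refl
    cached = filter (λ (p , a) → lookup E a ≟P inj₁ p) pairs
    marked : ∀ {x} → x ∈ map mark cached → x ∈ map (λ a → lookup E a , a) (allFin N)
    marked x∈ with (p , a) , pa∈ , refl ← ∈-map⁻ mark x∈ with _ , eq ← ∈-filter⁻ (λ (p , a) → lookup E a ≟P inj₁ p) {xs = pairs} pa∈ =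
      subst (λ z → (z , a) ∈ map (λ a → lookup E a , a) (allFin N)) eq (∈-map⁺ (λ a → lookup E a , a) (∈-allFin a))

  -- `InReach` without the cached atoms of writers. A block contributes at most `B` atoms and all
  -- caches together at most `N`, so the two kinds are counted apart.
  Reads : State → Fin (suc N) → Fin N → Set
  Reads E zero    a = ⊥
  Reads E (suc c) a = lookup E a ≡ lookup E c

  reads? : ∀ E α a → Dec (Reads E α a)
  reads? E zero    a = no λ ()
  reads? E (suc c) a = lookup E a ≟P lookup E c

  inReach⇒cached⊎reads : ∀ E α p a → InReach E α p a → lookup E a ≡ inj₁ p ⊎ Reads E α a
  inReach⇒cached⊎reads E zero p a r = inj₁ r
  inReach⇒cached⊎reads E (suc c) p a r = inj₂ r

  ∈-nexts : ∀ M s E E₁ (α : Letters) (mover : Fin N → Maybe (Fin P)) →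
    M ≤ suc d * B ⊎ N ≤ suc d * (P * B) →
    (∀ a p → mover a ≡ just p → Movable E α (p , a) × lookup E₁ a ≡ target s p (lookup α p)) →
    (∀ a → mover a ≡ nothing → lookup E₁ a ≡ lookup E a) →
    (∀ p → length (filter (λ a → Maybe.≡-dec _≟_ (mover a) (just p)) (allFin N)) ≤ B) →
    (∀ p → length (filter (λ a → movable? E α (p , a)) (allFin N)) ≤ M) →
    (∀ p → length (filter (λ a → reads? E (lookup α p) a) (allFin N)) ≤ B) →
    E₁ ∈ nexts s E
  ∈-nexts M s E E₁ α mover large moved unmoved few-moved few-movable few-read =
    there (∈-concatMap (nexts-with s E) (∈-allVecs α) (subst (_∈ nexts-with s E α) E₁≡ (∈-map⁺ (move s α E) moves∈)))
    where
    open ≤-Reasoning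
    length-allFin : ∀ k → length (allFin k) ≡ k
    length-allFin k = length-tabulate {n = k} id
    moved? : Decidable (λ (x : Fin P × Fin N) → mover (proj₂ x) ≡ just (proj₁ x))
    moved? (p , a) = Maybe.≡-dec _≟_ (mover a) (just p)
    all-movables = movables E α
    moves = filter moved? all-movables

    -- The cases correspond to the two terms of the minimum `d`: either each processor reaches at
    -- most `M` atoms, or all of them reach at most `N` cached atoms and `B` more per block read.
    -- The second case is the source of the factor 2.
    few-movables : length all-movables ≤ P * B * 2 * suc d
    few-movables = case large of λ where
      (inj₁ M≤) → begin
        length all-movables     ≤⟨ length-filter-cartesianProduct (movable? E α) M (allFin P) (allFin N) few-movable ⟩
        length (allFin P) * M   ≡⟨ cong (_* M) (length-allFin P) ⟩
        P * M                   ≤⟨ *-monoʳ-≤ P M≤ ⟩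
        P * (suc d * B)         ≡⟨ cong (P *_) (*-comm (suc d) B) ⟩
        P * (B * suc d)         ≡⟨ *-assoc P B (suc d) ⟨
        P * B * suc d           ≤⟨ *-monoˡ-≤ (suc d) (m≤m*n (P * B) 2) ⟩
        P * B * 2 * suc d       ∎
      (inj₂ N≤) → begin
        length all-movables
          ≤⟨ length-filter-⊎ (movable? E α) (λ (p , a) → lookup E a ≟P inj₁ p) (λ (p , a) → reads? E (lookup α p) a) pairs
                                     (λ (p , a) → inReach⇒cached⊎reads E (lookup α p) p a) ⟩
        length (filter (λ (p , a) → lookup E a ≟P inj₁ p) pairs) + length (filter (λ (p , a) → reads? E (lookup α p) a) pairs)
                                ≤⟨ +-mono-≤ (length-in-caches E) (length-filter-cartesianProduct (λ (p , a) → reads? E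
                                      (lookup α p) a) B (allFin P) (allFin N) few-read) ⟩
        N + length (allFin P) * B         ≡⟨ cong (λ k → N + k * B) (length-allFin P) ⟩
        N + P * B                         ≤⟨ +-mono-≤ N≤ (m≤m*n (P * B) (suc d)) ⟩
        suc d * (P * B) + P * B * suc d   ≡⟨ cong₂ _+_ (*-comm (suc d) (P * B)) (sym (+-identityʳ (P * B * suc d))) ⟩
        2 * (P * B * suc d)               ≡⟨ *-assoc 2 (P * B) (suc d) ⟨
        2 * (P * B) * suc d               ≡⟨ cong (_* suc d) (*-comm 2 (P * B)) ⟩
        P * B * 2 * suc d                 ∎

    few-moves : length moves ≤ P * B
    few-moves = begin
      length moves
        ≤⟨ unique-⊆⇒length≤ (Unique.filter⁺ moved? (Unique.filter⁺ (movable? E α) (Unique.cartesianProduct⁺ (Unique.allFin⁺ P)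
            (Unique.allFin⁺ N)))) sub ⟩
      length (filter moved? pairs)   ≤⟨ length-filter-cartesianProduct moved? B (allFin P) (allFin N) few-moved ⟩
      length (allFin P) * B          ≡⟨ cong (_* B) (length-allFin P) ⟩
      P * B                          ∎
      where
      sub : ∀ {x} → x ∈ moves → x ∈ filter moved? pairs
      sub x∈ with x∈m , eq ← ∈-filter⁻ moved? {xs = all-movables} x∈ = ∈-filter⁺ moved? (proj₁ (∈-filter⁻
            (movable? E α) {xs = pairs} x∈m)) eq

    moves∈ : moves ∈ subs (P * B) (take (P * B * 2 * suc d) all-movables)
    moves∈ = subst (λ xs → moves ∈ subs (P * B) xs) (sym (take-all (P * B * 2 * suc d) all-movables few-movables))
      (∈-subs moved? (P * B) all-movables few-moves)

    moved-by : ∀ {p a} → (p , a) ∈ moves → mover a ≡ just p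
    moved-by x∈ = proj₂ (∈-filter⁻ moved? {xs = all-movables} x∈)

    relocate≡ : ∀ a → relocate s α E moves a ≡ lookup E₁ a
    relocate≡ a with mover a in eq
    ... | just p with movable , to ← moved a p eq = trans
      (relocate-moved s α E moves
        (∈-filter⁺ moved? (∈-filter⁺ (movable? E α) (∈-cartesianProduct⁺ (∈-allFin p) (∈-allFin a)) movable) eq)
        (λ p'∈ → Maybe.just-injective (trans (sym (moved-by p'∈)) eq)))
      (sym to)
    ... | nothing = trans (relocate-unmoved s α E moves λ p p∈ → case trans (sym eq) (moved-by p∈) of λ ()) (sym (unmoved a eq))

    E₁≡ : move s α E moves ≡ E₁
    E₁≡ = trans (tabulate-cong relocate≡) (tabulate∘lookup E₁)

-- Runs of the machine

length-filter-∈ : ∀ {N} {Q : Fin N → Set} (Q? : Decidable Q) (S : Subset N) → (∀ a → Q a → a ∈ₛ S) → length (filter Q? (allFin N)) ≤ ∣ S ∣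
length-filter-∈ Q? S h = length-filter-tabulate-≤ Q? (Bool._≟ true) id S λ a q → []=⇒lookup (h a q)

foldr-just-or-nothing : ∀ {A S : Set} (f : A → Maybe S → Maybe S) (W : A → S → Set) →
  (∀ p r → f p r ≡ r ⊎ ∃ λ S → W p S × f p r ≡ just S) →
  ∀ ps → (∃ λ p → ∃ λ S → W p S × List.foldr f nothing ps ≡ just S) ⊎ List.foldr f nothing ps ≡ nothing
foldr-just-or-nothing f W h [] = inj₂ refl
foldr-just-or-nothing f W h (p ∷ ps) with h p (List.foldr f nothing ps)
... | inj₂ (S , w , eq) = inj₁ (p , S , w , eq)
... | inj₁ eq with foldr-just-or-nothing f W h ps
...   | inj₁ (p' , S , w , eq') = inj₁ (p' , S , w , trans eq eq')
...   | inj₂ eq' = inj₂ (trans eq eq')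

module _ {N P : ℕ} where

  Written : (Fin P → Act N) → ℕ → Set
  Written act b = (∃ λ p → ∃ λ S → act p ≡ wr b S × written act b ≡ just S) ⊎ written act b ≡ nothing

  -- The fold in the definition of written uses a local function, which unification names here.
  mutual
    writeBy : (Fin P → Act N) → ℕ → Fin P → Maybe (Subset N) → Maybe (Subset N)
    writeBy act b = _

    written≡foldr : ∀ act b → written act b ≡ List.foldr (writeBy act b) nothing (allFin P)
    written≡foldr act b = refl

  writeBy-view : ∀ act b p r → writeBy act b p r ≡ r ⊎ ∃ λ S → act p ≡ wr b S × writeBy act b p r ≡ just S
  writeBy-view act b p r with act p
  ... | idle = inj₁ refl
  ... | rd _ = inj₁ refl
  ... | wr b' S with b' ℕ.≟ b
  ...   | yes refl = inj₂ (S , refl , refl)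
  ...   | no _ = inj₁ refl

  written? : ∀ act b → Written act b
  written? act b = foldr-just-or-nothing (writeBy act b) (λ p S → act p ≡ wr b S) (writeBy-view act b) (allFin P)

  mem-written : ∀ (c : Config N P) st b {S} → written (IOStep.act st) b ≡ just S → Config.mem (applyStep c st) b ≡ S
  mem-written c st b eq with written (IOStep.act st) b
  mem-written c st b refl | just S = refl

  mem-unwritten : ∀ (c : Config N P) st b → written (IOStep.act st) b ≡ nothing → Config.mem (applyStep c st) b ≡ Config.mem c b
  mem-unwritten c st b eq with written (IOStep.act st) b
  mem-unwritten c st b refl | nothing = refl

module Simulation (N P M B d : ℕ) (B≤M : B ≤ M) (large : M ≤ suc d * B ⊎ N ≤ suc d * (P * B)) where
  open Tracing N P B d public

  -- The physical counterpart of `Place`: blocks go by address here, and `place` replaces the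
  -- address by the current version.
  Location : Set
  Location = Fin P ⊎ ℕ

  holds : Config N P → Location → Subset N
  holds c (inj₁ p) = Config.cache c p
  holds c (inj₂ b) = Config.mem c b

  record Bounded (c : Config N P) : Set where
    field
      mem≤   : ∀ b → ∣ Config.mem c b ∣ ≤ B
      cache≤ : ∀ p → ∣ Config.cache c p ∣ ≤ M

  -- `injective` lets a version stand for its block. `past` makes the versions written in the next
  -- step new, so that injectivity is preserved.
  record Versioning (s : ℕ) (ver : ℕ → ℕ × ℕ) : Set where
    field
      injective : ∀ b b' → ver b ≡ ver b' → b ≡ b'
      past      : ∀ b → proj₁ (ver b) ≤ s

  place : (ℕ → ℕ × ℕ) → Location → Place
  place ver (inj₁ p) = inj₁ p
  place ver (inj₂ b) = inj₂ (ver b)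

  state : (ℕ → ℕ × ℕ) → (Fin N → Location) → State
  state ver q = Vec.tabulate (place ver ∘ q)

  module Step (c : Config N P) (st : IOStep N P) (valid : ValidStep M B c st) (bounded : Bounded c)
              (s : ℕ) (ver : ℕ → ℕ × ℕ) (versioning : Versioning s ver) where
    open Config c
    open IOStep st
    open ValidStep valid
    open Bounded bounded
    open Versioning versioning

    c₁ : Config N P
    c₁ = applyStep c st

    version : ∀ b → Written act b → ℕ × ℕ
    version b (inj₁ (p , _)) = suc s , toℕ p
    version b (inj₂ _)       = ver b

    ver₁ : ℕ → ℕ × ℕ
    ver₁ b = version b (written? act b)

    versioning₁ : Versioning (suc s) ver₁
    versioning₁ = record { injective = λ b b' → inj b b' (written? act b) (written? act b') ; past = λ b → past₁ b (written? act b) }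
      where
      wr-injective : ∀ {b b' S S'} → wr {N} b S ≡ wr b' S' → b ≡ b'
      wr-injective refl = refl
      past₁ : ∀ b w → proj₁ (version b w) ≤ suc s
      past₁ b (inj₁ _) = ≤-refl
      past₁ b (inj₂ _) = m≤n⇒m≤1+n (past b)
      inj : ∀ b b' w w' → version b w ≡ version b' w' → b ≡ b'
      inj b b' (inj₁ (p , S , eq , _)) (inj₁ (p' , S' , eq' , _)) e with refl ← toℕ-injective (cong proj₂ e) =
        wr-injective (trans (sym eq) eq')
      inj b b' (inj₁ _) (inj₂ _) e = contradiction (past b') (<⇒≱ (≤-reflexive (cong proj₁ e)))
      inj b b' (inj₂ _) (inj₁ _) e = contradiction (past b) (<⇒≱ (≤-reflexive (cong proj₁ (sym e))))
      inj b b' (inj₂ _) (inj₂ _) e = injective b b' e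

    bounded₁ : Bounded c₁
    bounded₁ = record { mem≤ = mem₁≤ ; cache≤ = cache₁≤ }
      where
      mem₁≤ : ∀ b → ∣ Config.mem c₁ b ∣ ≤ B
      mem₁≤ b with written? act b
      ... | inj₁ (p , S , eq , eq') = subst (λ X → ∣ X ∣ ≤ B) (sym (mem-written c st b eq')) (writeSize p b S eq)
      ... | inj₂ eq = subst (λ X → ∣ X ∣ ≤ B) (sym (mem-unwritten c st b eq)) (mem≤ b)
      cache₁≤ : ∀ p → ∣ Config.cache c₁ p ∣ ≤ M
      cache₁≤ p with act p in eq
      ... | idle   = ≤-trans (p⊆q⇒∣p∣≤∣q∣ (keepSub p)) (cache≤ p)
      ... | wr _ _ = ≤-trans (p⊆q⇒∣p∣≤∣q∣ (keepSub p)) (cache≤ p)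
      ... | rd b   = readFits p b eq

    -- The step read backwards: where a copy present after the step was before it. The stored
    -- equations on versions ensure that an unmoved copy keeps its `Place` and a written copy
    -- receives the version of this step.
    data Origin (a : Fin N) : Location → Set where
      in-cache : ∀ {p} → a ∈ₛ cache p → Origin a (inj₁ p)
      in-block : ∀ {b} → a ∈ₛ mem b → ver₁ b ≡ ver b → Origin a (inj₂ b)
      read     : ∀ {p b} → act p ≡ rd b → a ∈ₛ mem b → Origin a (inj₁ p)
      write    : ∀ {p b S} → act p ≡ wr b S → a ∈ₛ S → a ∈ₛ cache p → ver₁ b ≡ (suc s , toℕ p) → Origin a (inj₂ b)

    source : ∀ {a ℓ} → Origin a ℓ → Location
    source (in-cache {p} _)    = inj₁ p
    source (in-block {b} _ _)  = inj₂ b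
    source (read {b = b} _ _)  = inj₂ b
    source (write {p} _ _ _ _) = inj₁ p

    mover : ∀ {a ℓ} → Origin a ℓ → Maybe (Fin P)
    mover (in-cache _)        = nothing
    mover (in-block _ _)      = nothing
    mover (read {p} _ _)      = just p
    mover (write {p} _ _ _ _) = just p

    source-holds : ∀ {a ℓ} (o : Origin a ℓ) → a ∈ₛ holds c (source o)
    source-holds (in-cache a∈)      = a∈
    source-holds (in-block a∈ _)    = a∈
    source-holds (read _ a∈)        = a∈
    source-holds (write _ _ a∈ _)   = a∈

    origin : ∀ a ℓ → a ∈ₛ holds c₁ ℓ → Origin a ℓ
    origin a (inj₁ p) a∈ with act p in eq
    ... | idle   = in-cache (keepSub p a∈)
    ... | wr _ _ = in-cache (keepSub p a∈)
    ... | rd b with x∈p∪q⁻ (keep p) (mem b) a∈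
    ...   | inj₁ kept    = in-cache (keepSub p kept)
    ...   | inj₂ fetched = read eq fetched
    origin a (inj₂ b) a∈ with written? act b in eq
    ... | inj₁ (p , S , eq₁ , eq₂) = write eq₁ a∈S (keepSub p (writeSub p b S eq₁ a∈S)) (cong (version b) eq)
      where a∈S = subst (a ∈ₛ_) (mem-written c st b eq₂) a∈
    ... | inj₂ eq₂ = in-block (subst (a ∈ₛ_) (mem-unwritten c st b eq₂) a∈) (cong (version b) eq)

    cargo : Act N → Subset N
    cargo idle     = ∅
    cargo (rd b)   = mem b
    cargo (wr b S) = S

    ∣cargo∣≤B : ∀ p → ∣ cargo (act p) ∣ ≤ B
    ∣cargo∣≤B p with act p in eq
    ... | idle   = ≤-trans (≤-reflexive (∣⊥∣≡0 N)) z≤n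
    ... | rd b   = mem≤ b
    ... | wr b S = writeSize p b S eq

    moved⇒cargo : ∀ {a ℓ p} (o : Origin a ℓ) → mover o ≡ just p → a ∈ₛ cargo (act p)
    moved⇒cargo (read eq a∈) refl = subst (λ x → _ ∈ₛ cargo x) (sym eq) a∈
    moved⇒cargo (write eq a∈ _ _) refl = subst (λ x → _ ∈ₛ cargo x) (sym eq) a∈

    unmoved⇒same-place : ∀ {a ℓ} (o : Origin a ℓ) → mover o ≡ nothing → place ver₁ ℓ ≡ place ver (source o)
    unmoved⇒same-place (in-cache _) refl = refl
    unmoved⇒same-place (in-block _ eq) refl = cong inj₂ eq

    module _ (q₁ : Fin N → Location) (q₁-holds : ∀ a → a ∈ₛ holds c₁ (q₁ a)) where

      o : ∀ a → Origin a (q₁ a)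
      o a = origin a (q₁ a) (q₁-holds a)

      q : Fin N → Location
      q a = source (o a)

      q-holds : ∀ a → a ∈ₛ holds c (q a)
      q-holds a = source-holds (o a)

      E E₁ : State
      E  = state ver q
      E₁ = state ver₁ q₁

      lookup-E : ∀ a → lookup E a ≡ place ver (q a)
      lookup-E = lookup∘tabulate (place ver ∘ q)

      -- A read that fetches no essential copy is treated like idling and gets the letter zero.
      -- Hence, whenever an essential copy is taken from a block, there is an atom that names this
      -- block.
      data Letter (p : Fin P) : Fin (suc N) → Set where
        writing : (∀ {b a} → act p ≡ rd b → q a ≢ inj₂ b) → Letter p zero
        reading : ∀ {b a} → act p ≡ rd b → q a ≡ inj₂ b → Letter p (suc a)

      letter : ∀ p → ∃ (Letter p)
      letter p with act p in eq
      ... | idle   = zero , writing λ eq' → contradiction (trans (sym eq) eq') λ ()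
      ... | wr _ _ = zero , writing λ eq' → contradiction (trans (sym eq) eq') λ ()
      ... | rd b with any? (λ a → Sum.≡-dec _≟_ ℕ._≟_ (q a) (inj₂ b))
      ...   | yes (a , qa) = suc a , reading eq qa
      ...   | no none = zero , writing λ {b'} {a} eq' qa → none (a , trans qa (cong inj₂ (rd-injective (trans (sym eq') eq))))
        where
        rd-injective : ∀ {b b'} → rd {N} b ≡ rd b' → b ≡ b'
        rd-injective refl = refl

      α : Letters
      α = Vec.tabulate (proj₁ ∘ letter)

      letter-α : ∀ p → Letter p (lookup α p)
      letter-α p = subst (Letter p) (sym (lookup∘tabulate (proj₁ ∘ letter) p)) (proj₂ (letter p))

      moved⇒inReach : ∀ {a ℓ p x} (o : Origin a ℓ) → Letter p x → q a ≡ source o → mover o ≡ just p →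
        InReach E x p a × place ver₁ ℓ ≡ target s p x
      moved⇒inReach (read eq a∈) (writing none) qa refl = contradiction qa (none eq)
      moved⇒inReach {a} (read {b = b} eq a∈) (reading {a = a'} eq' qa') qa refl with refl ← trans (sym eq) eq' =
        trans (lookup-E a) (trans (cong (place ver) (trans qa (sym qa'))) (sym (lookup-E a'))) , refl
      moved⇒inReach {a} (write eq a∈ _ eqv) (writing _) qa refl = trans (lookup-E a) (cong (place ver) qa) , cong inj₂ eqv
      moved⇒inReach (write eq a∈ _ eqv) (reading eq' qa') qa refl = contradiction (trans (sym eq) eq') λ ()

      at-cache : ∀ {a p} → lookup E a ≡ inj₁ p → a ∈ₛ cache p
      at-cache {a} {p} eq with q a | q-holds a | trans (sym (lookup-E a)) eq
      ... | inj₁ _ | a∈ | refl = a∈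

      -- Injectivity of `ver` turns equality of places back into equality of blocks.
      at-block : ∀ {a a' b} → q a' ≡ inj₂ b → lookup E a ≡ lookup E a' → a ∈ₛ mem b
      at-block {a} {a'} {b} qa' eq with q a | q-holds a | trans (sym (lookup-E a)) (trans eq (trans (lookup-E a') (cong (place ver) qa')))
      ... | inj₂ b' | a∈ | e = subst (λ x → a ∈ₛ mem x) (injective b' b (Sum.inj₂-injective e)) a∈

      few-inReach : ∀ {p x} → Letter p x → length (filter (inReach? E x p) (allFin N)) ≤ M
      few-inReach {p} (writing _) = ≤-trans (length-filter-∈ (inReach? E zero p) (cache p) (λ a → at-cache)) (cache≤ p)
      few-inReach {p} (reading {b} {a'} _ qa') =
        ≤-trans (length-filter-∈ (inReach? E (suc a') p) (mem b) (λ a → at-block qa')) (≤-trans (mem≤ b) B≤M)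

      few-reads : ∀ {p x} → Letter p x → length (filter (reads? E x) (allFin N)) ≤ B
      few-reads (writing _) = ≤-trans (length-filter-∈ (reads? E zero) ∅ (λ a ())) (≤-trans (≤-reflexive (∣⊥∣≡0 N)) z≤n)
      few-reads {p} (reading {b} {a'} _ qa') = ≤-trans (length-filter-∈ (reads? E (suc a')) (mem b) (λ a → at-block qa')) (mem≤ b)

      E₁∈nexts : E₁ ∈ nexts s E
      E₁∈nexts = ∈-nexts M s E E₁ α (λ a → mover (o a)) large
        (λ a p eq → let r , t = moved⇒inReach (o a) (letter-α p) refl eq in r , trans (lookup∘tabulate (place ver₁ ∘ q₁) a) t)
        (λ a eq → trans (lookup∘tabulate (place ver₁ ∘ q₁) a) (trans (unmoved⇒same-place (o a) eq) (sym (lookup-E a))))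
        (λ p → ≤-trans (length-filter-∈ (λ a → Maybe.≡-dec _≟_ (mover (o a)) (just p)) (cargo (act p)) (λ a → moved⇒cargo
              (o a))) (∣cargo∣≤B p))
        (λ p → few-inReach (letter-α p))
        (λ p → few-reads (letter-α p))

  record Traced (c : Config N P) (prog : List (IOStep N P)) (T s : ℕ) (ver : ℕ → ℕ × ℕ) (final : Fin N → ℕ) : Set where
    field
      start         : Fin N → Location
      start-holds   : ∀ a → a ∈ₛ holds c (start a)
      final-version : ℕ → ℕ × ℕ
      injective     : ∀ b b' → final-version b ≡ final-version b' → b ≡ b'
      mem≤          : ∀ b → ∣ Config.mem (run c prog) b ∣ ≤ B
      reachable     : state final-version (inj₂ ∘ final) ∈ reach T s (state ver start)

  -- The rest of the program is traced first, from the configuration after the first step; the start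
  -- locations found there are then pulled back through that step.
  trace : ∀ prog {T} → length prog ≤ T → ∀ c s ver → Bounded c → Versioning s ver → ValidRun M B c prog →
    ∀ final → (∀ a → a ∈ₛ Config.mem (run c prog) (final a)) → Traced c prog T s ver final
  trace [] {T} _ c s ver bounded versioning _ final final-holds = record
    { start = inj₂ ∘ final ; start-holds = final-holds ; final-version = ver ; injective = Versioning.injective versioning
    ; mem≤ = Bounded.mem≤ bounded ; reachable = ∈-reach-stay T s _ }
  trace (st ∷ prog) {suc T} (s≤s len) c s ver bounded versioning (valid , valids) final final-holds = record
    { start = q start start-holds ; start-holds = q-holds start start-holds ; final-version = final-version ; injective = injective
    ; mem≤ = mem≤ ; reachable = ∈-concatMap (reach T (suc s)) {xs = nexts s _} (E₁∈nexts start start-holds) reachable }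
    where
    open Step c st valid bounded s ver versioning
    open Traced (trace prog len c₁ (suc s) ver₁ bounded₁ versioning₁ valids final final-holds)

-- The empty run

module _ {n m : ℕ} (q : Fin m) where

  swapHead : Vec (Fin n) (suc m) → Vec (Fin n) (suc m)
  swapHead (x ∷ v) = lookup v q ∷ (v [ q ]≔ x)

  swapHead-involutive : ∀ v → swapHead (swapHead v) ≡ v
  swapHead-involutive (x ∷ v) = cong₂ _∷_ (lookup∘update q v x) (trans ([]≔-idempotent v q) ([]≔-lookup v q))

  swapHead-injective : ∀ {v w} → swapHead v ≡ swapHead w → v ≡ w
  swapHead-injective {v} {w} eq = trans (sym (swapHead-involutive v)) (trans (cong swapHead eq) (swapHead-involutive w))

count-swapHead : ∀ {A : Set} {P : A → Set} (P? : Decidable P) {m} (q : Fin m) x (v : Vec A m) →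
  count P? (lookup v q ∷ (v [ q ]≔ x)) ≡ count P? (x ∷ v)
count-swapHead P? zero x (y ∷ v) = count-swap P? y x v
count-swapHead P? (suc q) x (z ∷ v) = begin
  count P? (lookup v q ∷ z ∷ (v [ q ]≔ x))   ≡⟨ count-swap P? (lookup v q) z (v [ q ]≔ x) ⟩
  count P? (z ∷ lookup v q ∷ (v [ q ]≔ x))   ≡⟨ count-∷-cong P? z (lookup v q ∷ (v [ q ]≔ x)) (x ∷ v) (count-swapHead P? q x v) ⟩
  count P? (z ∷ x ∷ v)                       ≡⟨ count-swap P? z x v ⟩
  count P? (x ∷ z ∷ v)                       ∎
  where open ≡-Reasoning

Respects : ∀ {n m} → (Fin m → ℕ) → Vec (Fin n) m → Set
Respects g v = ∀ i i' → lookup v i ≡ lookup v i' → g i ≡ g i'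

module _ {n m : ℕ} (q : Fin m) (g : Fin (suc m) → ℕ) (separated : g zero ≢ g (suc q)) where

  swapHead-valid : ∀ {v : Vec (Fin n) (suc m)} → Valid v → Valid (swapHead q v)
  swapHead-valid {x ∷ v} val j = trans (count-swapHead (_≟ j) q x v) (val j)

  -- The head receives the label `y` of atom `suc q`. The other atom with label `y` is untouched by
  -- the swap, so it shares its `g`-value with `suc q` before the swap and with the head after it,
  -- against `separated`.
  swapHead-disrespects : ∀ {v : Vec (Fin n) (suc m)} → Valid v → Respects g v → ¬ Respects g (swapHead q v)
  swapHead-disrespects {x ∷ v} val resp resp' =
    separated (trans (resp' zero (suc i) (sym at-i)) (resp (suc i) (suc q) (trans (sym (lookup∘update′ i≢q v x)) at-i)))
    where
    y = lookup v q
    x≢y : x ≢ y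
    x≢y x≡y = separated (resp zero (suc q) x≡y)
    partner : ∃ λ i → lookup (v [ q ]≔ x) i ≡ y
    partner = count>0⇒some (_≟ y) (v [ q ]≔ x) (≤-reflexive (suc-injective (trans (sym (swapHead-valid {x ∷ v} val y))
          (count-∷-yes (_≟ y) (v [ q ]≔ x) refl))))
    i = proj₁ partner
    at-i = proj₂ partner
    i≢q : i ≢ q
    i≢q i≡q = x≢y (trans (sym (lookup∘update q v x)) (trans (cong (lookup (v [ q ]≔ x)) (sym i≡q)) at-i))

  ++-swapHead-unique : (L : List (Vec (Fin n) (suc m))) → Unique L → All (λ v → Valid v × Respects g v) L → Unique (L ++ map (swapHead q) L)
  ++-swapHead-unique L u good = Unique.++⁺ u (Unique.map⁺ (swapHead-injective q) u) λ (v∈ , w∈) → case ∈-map⁻ (swapHead q) w∈ of λ where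
    (w , w∈L , refl) → let val , resp = All.lookup good w∈L in swapHead-disrespects {w} val resp (proj₂ (All.lookup good v∈))

  ++-swapHead-valid : (L : List (Vec (Fin n) (suc m))) → All (λ v → Valid v × Respects g v) L → All Valid (L ++ map (swapHead q) L)
  ++-swapHead-valid L good = All.tabulate λ v∈ → case ∈-++⁻ L v∈ of λ where
    (inj₁ v∈L) → proj₁ (All.lookup good v∈L)
    (inj₂ v∈s) → case ∈-map⁻ (swapHead q) v∈s of λ where
      (w , w∈L , refl) → swapHead-valid {w} (proj₁ (All.lookup good w∈L))

module _ (N P B : ℕ) .{{_ : NonZero B}} where

  ∈-init⇒≡ : ∀ a b → a ∈ₛ Config.mem (initConfig N P B) b → toℕ a / B ≡ b
  ∈-init⇒≡ a b a∈ = ≡ᵇ⇒≡ _ b (subst T (trans (sym ([]=⇒lookup a∈)) (lookup∘tabulate (λ i → (toℕ i / B) ≡ᵇ b) a)) _)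

  init-mem≤ : ∀ b → ∣ Config.mem (initConfig N P B) b ∣ ≤ B
  init-mem≤ b = begin
    ∣ S ∣                                        ≤⟨ count-≤-length-filter-tabulate in-S? (Bool._≟ true) id S (λ i e → e) ⟩
    length (filter in-S? (allFin N))             ≡⟨ length-map toℕ (filter in-S? (allFin N)) ⟨
    length (map toℕ (filter in-S? (allFin N)))
      ≤⟨ unique-⊆⇒length≤ (Unique.map⁺ toℕ-injective (Unique.filter⁺ in-S? (Unique.allFin⁺ N))) sub ⟩
    length (map (_+ b * B) (upTo B))             ≡⟨ length-map (_+ b * B) (upTo B) ⟩
    length (upTo B)                              ≡⟨ length-upTo B ⟩
    B                                            ∎
    where
    open ≤-Reasoning
    S = Config.mem (initConfig N P B) b
    in-S? : Decidable (λ i → lookup S i ≡ true)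
    in-S? i = lookup S i Bool.≟ true
    sub : ∀ {x} → x ∈ map toℕ (filter in-S? (allFin N)) → x ∈ map (_+ b * B) (upTo B)
    sub x∈ with i , i∈ , refl ← ∈-map⁻ toℕ x∈ =
      subst (_∈ map (_+ b * B) (upTo B))
        (sym (trans (m≡m%n+[m/n]*n (toℕ i) B) (cong (λ k → toℕ i % B + k * B) (∈-init⇒≡ i b (lookup⇒[]= i S (proj₂
              (∈-filter⁻ in-S? {xs = allFin N} i∈)))))))
        (∈-map⁺ (_+ b * B) (∈-upTo⁺ (m%n<n (toℕ i) B)))

module _ {n P M B : ℕ} .{{_ : NonZero B}} {v : Labeling n} where

  solvable-0⇒respects : SolvableIn n P M B v 0 → Respects (λ i → toℕ i / B) v
  solvable-0⇒respects ([] , _ , _ , solves) i i' eq with b , all ← solves (lookup v i) =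
    trans (∈-init⇒≡ (2 * n) P B i b (all i refl)) (sym (∈-init⇒≡ (2 * n) P B i' b (all i' (sym eq))))

solvable-0⇒half : ∀ n P M B .{{_ : NonZero B}} → B < 2 * n → (L : List (Labeling n)) → Unique L →
  All (λ v → ValidLabeling n v × SolvableIn n P M B v 0) L → 2 * length L ≤ numInstances n
solvable-0⇒half (suc k) P M (suc B) B<N L u easy = begin
  2 * length L                               ≡⟨ cong (length L +_) (trans (+-identityʳ (length L)) (sym (length-map (swapHead q) L))) ⟩
  length L + length (map (swapHead q) L)     ≡⟨ length-++ L ⟨
  length (L ++ map (swapHead q) L)
    ≤⟨ unique-valid⇒length≤numInstances (suc k) _ (++-swapHead-unique q g separated L u good)
        (++-swapHead-valid q g separated L good) ⟩
  numInstances (suc k)                       ∎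
  where
  open ≤-Reasoning
  g : Fin (2 * suc k) → ℕ
  g i = toℕ i / suc B
  q : Fin (k + suc (k + 0))
  -- Atom `suc q` has the number `suc B`, which is the block size: it is the first atom of block 1,
  -- while atom zero lies in block 0.
  q = fromℕ< (s≤s⁻¹ B<N)
  separated : g zero ≢ g (suc q)
  separated eq = contradiction (trans (sym (0/n≡0 (suc B))) (trans eq (trans (cong (λ z → suc z / suc B) (toℕ-fromℕ<
        (s≤s⁻¹ B<N))) (n/n≡1 (suc B))))) λ ()
  good : All (λ v → Valid v × Respects g v) L
  good = All.map (λ {v} (val , sol) → val , solvable-0⇒respects {suc k} {P} {M} {suc B} {v} sol) easy

-- Instances solvable within a given number of steps

module Counting (n P M B d : ℕ) .{{_ : NonZero B}} (B≤M : B ≤ M) (large : M ≤ suc d * B ⊎ 2 * n ≤ suc d * (P * B)) where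
  open Simulation (2 * n) P M B d B≤M large
  open Compatible _≟P_ B

  -- Initially the caches are empty and every atom lies in a single block, so all runs start from
  -- this state, whichever copies turn out to be essential.
  start-state : State
  start-state = Vec.tabulate λ a → inj₂ (0 , toℕ a / B)

  candidates : ℕ → List (Labeling n)
  candidates T = concatMap (compatible n (2 * n)) (reach T 0 start-state)

  length-candidates : ∀ T → length (candidates T) ≤ branching ^ T * (n ! * B ^ n)
  length-candidates T = ≤-trans (length-concatMap-≤ (compatible n (2 * n)) (n ! * B ^ n) (reach T 0 start-state)
        (length-compatible n (2 * n)))
    (*-monoˡ-≤ (n ! * B ^ n) (length-reach T 0 start-state))

  ∈-candidates : ∀ {T t v} → t ≤ T → ValidLabeling n v → SolvableIn n P M B v t → v ∈ candidates T
  ∈-candidates {T} {v = v} t≤T val (prog , refl , valids , solves) =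
    ∈-concatMap (compatible n (2 * n)) {xs = reach T 0 start-state}
      (subst (λ E → state final-version (inj₂ ∘ final) ∈ reach T 0 E) start≡ reachable)
      (∈-compatible n (2 * n) β v val
        (λ i i' eq → trans (lookup-β i) (trans (cong (λ j → inj₂ (final-version (proj₁ (solves j)))) eq) (sym (lookup-β i'))))
        small)
    where
    -- An atom is sent to the block that `solves` names for its label. Thus equal labels get equal
    -- places even if further copies lie in other blocks.
    final : Fin (2 * n) → ℕ
    final a = proj₁ (solves (lookup v a))
    init = initConfig (2 * n) P B
    bounded : Bounded init
    bounded = record { mem≤ = init-mem≤ (2 * n) P B
                     ; cache≤ = λ p → ≤-trans (p⊆q⇒∣p∣≤∣q∣ {p = Config.cache init p} {q = ∅ {2 * n}} (λ {a} a∈ → contradiction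
                           (trans (sym ([]=⇒lookup a∈)) (lookup∘tabulate (λ _ → false) a)) λ ()))
                                                (≤-trans (≤-reflexive (∣⊥∣≡0 (2 * n))) z≤n) }
    versioning : Versioning 0 (0 ,_)
    versioning = record { injective = λ { b .b refl → refl } ; past = λ b → z≤n }
    open Traced (trace prog t≤T init 0 (0 ,_) bounded versioning valids final (λ a → proj₂ (solves (lookup v a)) a refl))
    β : State
    β = state final-version (inj₂ ∘ final)
    lookup-β : ∀ a → lookup β a ≡ inj₂ (final-version (final a))
    lookup-β = lookup∘tabulate (λ a → inj₂ (final-version (final a)))
    start-place : ∀ a ℓ → a ∈ₛ holds init ℓ → place (0 ,_) ℓ ≡ inj₂ (0 , toℕ a / B)
    start-place a (inj₁ p) a∈ = contradiction (trans (sym ([]=⇒lookup a∈)) (lookup∘tabulate (λ _ → false) a)) λ ()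
    start-place a (inj₂ b) a∈ = cong (λ z → inj₂ (0 , z)) (sym (∈-init⇒≡ (2 * n) P B a b a∈))
    start≡ : state (0 ,_) start ≡ start-state
    start≡ = tabulate-cong λ a → start-place a (start a) (start-holds a)
    small : ∀ i → count (_≟P lookup β i) β ≤ B
    small i = ≤-trans (count-mono (_≟P lookup β i) (Bool._≟ true) β (Config.mem (run init prog) (final i)) same) (mem≤ (final i))
      where
      same : ∀ a → lookup β a ≡ lookup β i → lookup (Config.mem (run init prog) (final i)) a ≡ true
      same a eq = []=⇒lookup (subst (λ b → a ∈ₛ Config.mem (run init prog) b)
        (injective (final a) (final i) (Sum.inj₂-injective (trans (sym (lookup-β a)) (trans eq (lookup-β i)))))
        (proj₂ (solves (lookup v a)) a refl))

-- Estimates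

^-distribʳ-* : ∀ n a b → (a * b) ^ n ≡ a ^ n * b ^ n
^-distribʳ-* zero a b = refl
^-distribʳ-* (suc n) a b = trans (cong (a * b *_) (^-distribʳ-* n a b)) ([m*n]*[o*p]≡[m*o]*[n*p] a b (a ^ n) (b ^ n))

n<2^n : ∀ n → n < 2 ^ n
n<2^n zero = s≤s z≤n
n<2^n (suc n) = +-mono-≤-< (m^n>0 2 n) (≤-trans (n<2^n n) (≤-reflexive (sym (+-identityʳ (2 ^ n)))))

n<2^[1+⌊log₂n⌋] : ∀ n → n < 2 ^ suc ⌊log₂ n ⌋
n<2^[1+⌊log₂n⌋] n = ≰⇒> λ le → 1+n≰n (≤-trans (≤-reflexive (sym (⌊log₂[2^n]⌋≡n (suc ⌊log₂ n ⌋)))) (⌊log₂⌋-mono-≤ le))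

2^⌊log₂n⌋≤n : ∀ n → 0 < n → 2 ^ ⌊log₂ n ⌋ ≤ n
2^⌊log₂n⌋≤n = <-rec (λ n → 0 < n → 2 ^ ⌊log₂ n ⌋ ≤ n) step
  where
  open ≤-Reasoning
  step : ∀ n → (∀ {m} → m < n → 0 < m → 2 ^ ⌊log₂ m ⌋ ≤ m) → 0 < n → 2 ^ ⌊log₂ n ⌋ ≤ n
  step (suc zero) rec _ = ≤-refl
  step n@(suc (suc k)) rec _ = begin
    2 ^ ⌊log₂ n ⌋              ≡⟨ cong (2 ^_) (suc-pred ⌊log₂ n ⌋ {{>-nonZero (⌊log₂⌋-mono-≤ {2} {n} (s≤s (s≤s z≤n)))}}) ⟨
    2 * 2 ^ pred ⌊log₂ n ⌋     ≡⟨ cong (λ z → 2 * 2 ^ z) (⌊log₂⌊n/2⌋⌋≡⌊log₂n⌋∸1 n) ⟨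
    2 * 2 ^ ⌊log₂ ⌊ n /2⌋ ⌋    ≤⟨ *-monoʳ-≤ 2 (rec (⌊n/2⌋<n (suc k)) (s≤s z≤n)) ⟩
    2 * ⌊ n /2⌋                ≡⟨ cong (⌊ n /2⌋ +_) (+-identityʳ ⌊ n /2⌋) ⟩
    ⌊ n /2⌋ + ⌊ n /2⌋          ≤⟨ +-monoʳ-≤ ⌊ n /2⌋ (⌊n/2⌋≤⌈n/2⌉ n) ⟩
    ⌊ n /2⌋ + ⌈ n /2⌉          ≡⟨ ⌊n/2⌋+⌈n/2⌉≡n n ⟩
    n                          ∎

-- (1 + 1/n)^k ≤ n / (n - k), the inverse of Bernoulli's inequality for 1 - 1/n, with r = n - k.
[1+n]^k*r≤n^[1+k] : ∀ n k r → n ≡ k + r → suc n ^ k * r ≤ n ^ suc k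
[1+n]^k*r≤n^[1+k] n zero r eq = ≤-reflexive (trans (*-identityˡ r) (trans (sym eq) (sym (*-identityʳ n))))
[1+n]^k*r≤n^[1+k] n (suc k) r eq = begin
  suc n * suc n ^ k * r        ≡⟨ rearrange (suc n) (suc n ^ k) r ⟩
  suc n ^ k * (r + n * r)      ≤⟨ *-monoʳ-≤ (suc n ^ k) (+-monoˡ-≤ (n * r) r≤n) ⟩
  suc n ^ k * (n + n * r)      ≡⟨ cong (suc n ^ k *_) (*-suc n r) ⟨
  suc n ^ k * (n * suc r)      ≡⟨ rearrange′ (suc n ^ k) n (suc r) ⟩
  n * (suc n ^ k * suc r)      ≤⟨ *-monoʳ-≤ n ([1+n]^k*r≤n^[1+k] n k (suc r) (trans eq (sym (+-suc k r)))) ⟩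
  n * n ^ suc k                ∎
  where
  open ≤-Reasoning
  r≤n : r ≤ n
  r≤n = ≤-trans (m≤n+m r (suc k)) (≤-reflexive (sym eq))
  rearrange : ∀ a b c → a * b * c ≡ b * (a * c)
  rearrange = solve-∀
  rearrange′ : ∀ a b c → a * (b * c) ≡ b * (a * c)
  rearrange′ = solve-∀

-- Here k is at most n / 2, so n / (n - k) is at most 2.
[1+n]^k≤2n^k : ∀ n k r .{{_ : NonZero r}} → n ≡ k + r → k ≤ r → suc n ^ k ≤ 2 * n ^ k
[1+n]^k≤2n^k n k r eq k≤r = *-cancelʳ-≤ (suc n ^ k) (2 * n ^ k) r (begin
  suc n ^ k * r      ≤⟨ [1+n]^k*r≤n^[1+k] n k r eq ⟩
  n * n ^ k          ≤⟨ *-monoˡ-≤ (n ^ k) (≤-trans (≤-reflexive eq) (+-mono-≤ k≤r (≤-reflexive (sym (+-identityʳ r))))) ⟩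
  2 * r * n ^ k      ≡⟨ rearrange 2 r (n ^ k) ⟩
  2 * n ^ k * r      ∎)
  where
  open ≤-Reasoning
  rearrange : ∀ a b c → a * b * c ≡ a * c * b
  rearrange = solve-∀

-- A crude form of (1 + 1/n)^n < e: the exponent is split into halves, each half costs a factor 2,
-- and an odd n one factor 2 more.
[1+n]^n≤8n^n : ∀ n → suc n ^ n ≤ 8 * n ^ n
[1+n]^n≤8n^n zero = s≤s z≤n
[1+n]^n≤8n^n n@(suc m) = begin
  suc n ^ n                  ≡⟨ cong (suc n ^_) n≡k+r ⟩
  suc n ^ (k + r)            ≡⟨ ^-distribˡ-+-* (suc n) k r ⟩
  suc n ^ k * suc n ^ r      ≤⟨ *-mono-≤ ([1+n]^k≤2n^k n k r n≡k+r k≤r) ([1+n]^r≤4n^r (r≤1+k n)) ⟩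
  2 * n ^ k * (4 * n ^ r)    ≡⟨ rearrange (n ^ k) (n ^ r) ⟩
  8 * (n ^ k * n ^ r)        ≡⟨ cong (8 *_) (^-distribˡ-+-* n k r) ⟨
  8 * n ^ (k + r)            ≡⟨ cong (λ z → 8 * n ^ z) n≡k+r ⟨
  8 * n ^ n                  ∎
  where
  open ≤-Reasoning
  k = ⌊ n /2⌋
  r = ⌈ n /2⌉
  k≤r : k ≤ r
  k≤r = ⌊n/2⌋≤⌈n/2⌉ n
  n≡k+r : n ≡ k + r
  n≡k+r = sym (⌊n/2⌋+⌈n/2⌉≡n n)
  r≤1+k : ∀ n → ⌈ n /2⌉ ≤ suc ⌊ n /2⌋
  r≤1+k zero = z≤n
  r≤1+k (suc zero) = ≤-refl
  r≤1+k (suc (suc n)) = s≤s (r≤1+k n)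
  rearrange : ∀ a b → 2 * a * (4 * b) ≡ 8 * (a * b)
  rearrange = solve-∀
  rearrange′ : ∀ a b → 2 * a * (2 * b) ≡ 4 * (a * b)
  rearrange′ = solve-∀
  [1+n]^r≤4n^r : ∀ {r} → r ≤ suc k → suc n ^ r ≤ 4 * n ^ r
  [1+n]^r≤4n^r {r'} r≤ with r' ≤? k
  ... | yes r≤k = begin
    suc n ^ r'         ≤⟨ [1+n]^k≤2n^k n r' (r + (k ∸ r')) (trans n≡k+r (split r≤k)) (≤-trans r≤k (≤-trans k≤r (m≤m+n r (k ∸ r')))) ⟩
    2 * n ^ r'         ≤⟨ *-monoˡ-≤ (n ^ r') (m≤m+n 2 2) ⟩
    4 * n ^ r'         ∎
    where
    split : r' ≤ k → k + r ≡ r' + (r + (k ∸ r'))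
    split le = trans (cong (_+ r) (sym (m+[n∸m]≡n le))) (trans (+-assoc r' (k ∸ r') r) (cong (r' +_) (+-comm (k ∸ r') r)))
  ... | no r≰k with refl ← ≤-antisym r≤ (≰⇒> r≰k) = begin
    suc n * suc n ^ k        ≤⟨ *-mono-≤ 1+n≤2n ([1+n]^k≤2n^k n k r n≡k+r k≤r) ⟩
    2 * n * (2 * n ^ k)      ≡⟨ rearrange′ n (n ^ k) ⟩
    4 * (n * n ^ k)          ∎
    where
    1+n≤2n : suc n ≤ 2 * n
    1+n≤2n = +-mono-≤ (s≤s {0} {m} z≤n) (≤-reflexive (sym (+-identityʳ n)))

-- Used in place of Stirling's formula. From n to n + 1 the left side grows by the factor (2n + 2)
-- (1 + 1/n)^n, at most 16 (n + 1), and the right side by 16 (2n + 1).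
[2n]^n≤16^n*oddFactorial : ∀ n → (2 * n) ^ n ≤ 16 ^ n * oddFactorial n
[2n]^n≤16^n*oddFactorial zero = ≤-refl
[2n]^n≤16^n*oddFactorial (suc n) = begin
  2 * suc n * (2 * suc n) ^ n                                 ≡⟨ cong (2 * suc n *_) (^-distribʳ-* n 2 (suc n)) ⟩
  2 * suc n * (2 ^ n * suc n ^ n)                             ≤⟨ *-monoʳ-≤ (2 * suc n) (*-monoʳ-≤ (2 ^ n) ([1+n]^n≤8n^n n)) ⟩
  2 * suc n * (2 ^ n * (8 * n ^ n))                           ≡⟨ rearrange (suc n) (2 ^ n) (n ^ n) ⟩
  16 * suc n * (2 ^ n * n ^ n)                                ≡⟨ cong (16 * suc n *_) (^-distribʳ-* n 2 n) ⟨
  16 * suc n * (2 * n) ^ n                                    ≤⟨ *-mono-≤ (*-monoʳ-≤ 16 (s≤s n≤double)) ([2n]^n≤16^n*oddFactorial n) ⟩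
  16 * suc (double n) * (16 ^ n * oddFactorial n)             ≡⟨ [m*n]*[o*p]≡[m*o]*[n*p] 16 (suc (double n)) (16 ^ n) (oddFactorial n) ⟩
  16 ^ suc n * oddFactorial (suc n)                           ∎
  where
  open ≤-Reasoning
  rearrange : ∀ a b c → 2 * a * (b * (8 * c)) ≡ 16 * a * (b * c)
  rearrange = solve-∀
  n≤double : n ≤ double n
  n≤double = ≤-trans (m≤m+n n (n + 0)) (≤-reflexive (sym (double≡2* n)))

m<[1+m/n]*n : ∀ m n .{{_ : NonZero n}} → m < suc (m / n) * n
m<[1+m/n]*n m n = ≤-<-trans (≤-reflexive (m≡m%n+[m/n]*n m n)) (+-monoˡ-< (m / n * n) (m%n<n m n))

module Estimates (c n P M B T : ℕ) .{{_ : NonZero P}} .{{_ : NonZero B}}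
  (c-large : 16384 ≤ c) (PB<N : P * B < 2 * n) (T>0 : 0 < T) (cT≤perm : c * T ≤ permNat (2 * n) M B P) where

  open ≤-Reasoning

  N W x y ℓ d g h : ℕ
  N = 2 * n
  W = P * B
  x = N / B
  instance
    W≢0 : NonZero W
    W≢0 = m*n≢0 P B
  y = N / W
  d = (M / B) ⊓ y
  ℓ = ⌊log₂ x ⌋
  g = suc (⌊log₂ dPar N M B P ⌋ ∸ 1)
  h = suc ⌊log₂ N ⌋

  B≤W : B ≤ W
  B≤W = m≤n*m B P

  -- Both quotients in `d` are rounded down, hence `suc d`; the one that attains the minimum
  -- supplies its side of the disjunction.
  d-large : M ≤ suc d * B ⊎ N ≤ suc d * W
  d-large with ⊓-sel (M / B) y
  ... | inj₁ eq = inj₁ (≤-trans (<⇒≤ (m<[1+m/n]*n M B)) (≤-reflexive (cong (λ z → suc z * B) (sym eq))))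
  ... | inj₂ eq = inj₂ (≤-trans (<⇒≤ (m<[1+m/n]*n N W)) (≤-reflexive (cong (λ z → suc z * W) (sym eq))))

  y≤x : y ≤ x
  y≤x = /-monoʳ-≤ N B≤W

  log-dPar : ⌊log₂ dPar N M B P ⌋ ≡ g
  log-dPar = sym (suc-pred ⌊log₂ dPar N M B P ⌋ {{>-nonZero (⌊log₂⌋-mono-≤ {2} (m≤m⊔n 2 d))}})

  -- Twice `dPar` is at most `2 ^ (2 + g)`, and `g` is at least 1.
  2+d≤8^g : suc (suc d) ≤ 2 ^ (3 * g)
  2+d≤8^g = begin
    2 + d                                  ≤⟨ +-mono-≤ (m≤m⊔n 2 d) (m≤n⊔m 2 d) ⟩
    dPar N M B P + dPar N M B P            ≤⟨ +-mono-≤ dPar≤ dPar≤ ⟩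
    2 ^ suc g + 2 ^ suc g                  ≡⟨ cong (2 ^ suc g +_) (+-identityʳ (2 ^ suc g)) ⟨
    2 ^ suc (suc g)                        ≤⟨ ^-monoʳ-≤ 2 (≤-trans (+-monoˡ-≤ g (*-monoʳ-≤ 2 (s≤s z≤n))) (≤-reflexive (+-comm (2 * g) g))) ⟩
    2 ^ (3 * g)                            ∎
    where
    dPar≤ : dPar N M B P ≤ 2 ^ suc g
    dPar≤ = <⇒≤ (subst (λ z → dPar N M B P < 2 ^ suc z) log-dPar (n<2^[1+⌊log₂n⌋] (dPar N M B P)))

  cTP≤N : c * T * P ≤ N
  cTP≤N = ≤-trans (*-monoˡ-≤ P (≤-trans cT≤perm (m⊓n≤m (N / P) _))) (m/n*n≤m N P)

  cT≤scan : c * T ≤ y * (1 ⊔ ℓ / g)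
  cT≤scan = ≤-trans cT≤perm (m⊓n≤n (N / P) _)

  -- For ℓ at most 9 the claimed bound is at most 2^10 * 9 = 9216, less than `c`, which leaves no
  -- positive `T`. The constant 16384 is the next power of two; the 10 is what `exponents` consumes.
  10≤ℓ : 10 ≤ ℓ
  10≤ℓ = ≰⇒> λ ℓ≤9 → <⇒≱ {9216} {16384} (toWitness {a? = 9217 ≤? 16384} _) (begin
    16384              ≤⟨ c-large ⟩
    c                  ≤⟨ m≤m*n c T {{>-nonZero T>0}} ⟩
    c * T              ≤⟨ cT≤scan ⟩
    y * (1 ⊔ ℓ / g)    ≤⟨ *-mono-≤ (≤-trans y≤x (<⇒≤ (n<2^[1+⌊log₂n⌋] x))) (⊔-mono-≤ ≤-refl (m/n≤m ℓ g)) ⟩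
    2 ^ suc ℓ * (1 ⊔ ℓ)  ≤⟨ *-mono-≤ (^-monoʳ-≤ 2 (s≤s ℓ≤9)) (⊔-mono-≤ (s≤s {0} {8} z≤n) ℓ≤9) ⟩
    9216               ∎)

  1≤ℓ : 1 ≤ ℓ
  1≤ℓ = ≤-trans (s≤s z≤n) 10≤ℓ

  N>0 : 0 < N
  N>0 = ≤-<-trans z≤n PB<N

  2≤N : 2 ≤ N
  2≤N = *-monoʳ-≤ 2 (*-cancelˡ-< 2 0 n N>0)

  x>1 : 1 < x
  x>1 = ≰⇒> λ x≤1 → <⇒≱ 10≤ℓ (≤-trans (⌊log₂⌋-mono-≤ x≤1) z≤n)

  g≤ℓ : g ≤ ℓ
  g≤ℓ = ≤-trans (≤-reflexive (sym log-dPar)) (⌊log₂⌋-mono-≤ (⊔-lub x>1 (≤-trans (m⊓n≤n (M / B) y) y≤x)))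

  -- Up to a constant, `T * g * W` is the number of bits that describe all transfers. Multiplying by
  -- `W * g` undoes both divisions in the second term of `permNat`; the maximum with 1 is harmless
  -- by `g≤ℓ`.
  cTgW≤Nℓ : c * (T * g * W) ≤ N * ℓ
  cTgW≤Nℓ = begin
    c * (T * g * W)            ≡⟨ rearrange c T g W ⟩
    c * T * (W * g)            ≤⟨ *-monoˡ-≤ (W * g) cT≤scan ⟩
    y * (1 ⊔ ℓ / g) * (W * g)  ≡⟨ [m*n]*[o*p]≡[m*o]*[n*p] y (1 ⊔ ℓ / g) W g ⟩
    y * W * ((1 ⊔ ℓ / g) * g)  ≤⟨ *-mono-≤ (m/n*n≤m N W) (≤-trans (≤-reflexive (*-distribʳ-⊔ g 1 (ℓ / g)))
                                    (⊔-lub (≤-trans (≤-reflexive (*-identityˡ g)) g≤ℓ) (m/n*n≤m ℓ g))) ⟩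
    N * ℓ                      ∎
    where
    rearrange : ∀ a b c d → a * (b * c * d) ≡ a * b * (d * c)
    rearrange = solve-∀

  -- An address costs about log N bits. Either log N is comparable with log (N / B), or B exceeds N / B and the
  -- B atoms transferred by the same I/O pay for it.
  h≤4ℓ⊎h≤2B : h ≤ 4 * ℓ ⊎ h ≤ 2 * B
  h≤4ℓ⊎h≤2B with h ≤? 4 * ℓ
  ... | yes h≤ = inj₁ h≤
  ... | no h≰ = inj₂ (begin
    h                   ≡⟨ cong suc λ≡ ⟨
    suc (suc ℓ + u)     ≡⟨ cong suc (+-comm (suc ℓ) u) ⟩
    suc (u + suc ℓ)     ≤⟨ s≤s (+-monoʳ-≤ u 1+ℓ≤u) ⟩
    suc u + u           ≤⟨ +-mono-≤ 1+u≤B (≤-trans (n≤1+n u) (≤-trans 1+u≤B (≤-reflexive (sym (+-identityʳ B))))) ⟩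
    2 * B               ∎)
    where
    1+ℓ+1+ℓ≤ : suc ℓ + suc ℓ ≤ ⌊log₂ N ⌋
    1+ℓ+1+ℓ≤ = ≤-trans (≤-reflexive (rearrange ℓ)) (≤-trans (+-monoʳ-≤ (2 * ℓ) (*-monoʳ-≤ 2 1≤ℓ)) (≤-trans (≤-reflexive
          (rearrange′ ℓ)) (s≤s⁻¹ (≰⇒> h≰))))
      where
      rearrange : ∀ a → suc a + suc a ≡ 2 * a + 2 * 1
      rearrange = solve-∀
      rearrange′ : ∀ a → 2 * a + 2 * a ≡ 4 * a
      rearrange′ = solve-∀
    1+ℓ≤ : suc ℓ ≤ ⌊log₂ N ⌋
    1+ℓ≤ = ≤-trans (m≤m+n (suc ℓ) (suc ℓ)) 1+ℓ+1+ℓ≤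
    u = ⌊log₂ N ⌋ ∸ suc ℓ
    λ≡ : suc ℓ + u ≡ ⌊log₂ N ⌋
    λ≡ = m+[n∸m]≡n 1+ℓ≤
    1+ℓ≤u : suc ℓ ≤ u
    1+ℓ≤u = m+n≤o⇒m≤o∸n (suc ℓ) 1+ℓ+1+ℓ≤
    1+u≤B : suc u ≤ B
    1+u≤B = ≤-trans (n<2^n u) (<⇒≤ (*-cancelˡ-< (2 ^ suc ℓ) (2 ^ u) B (begin-strict
      2 ^ suc ℓ * 2 ^ u      ≡⟨ ^-distribˡ-+-* 2 (suc ℓ) u ⟨
      2 ^ (suc ℓ + u)        ≡⟨ cong (2 ^_) λ≡ ⟩
      2 ^ ⌊log₂ N ⌋          ≤⟨ 2^⌊log₂n⌋≤n N N>0 ⟩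
      N                      <⟨ m<[1+m/n]*n N B ⟩
      suc x * B              ≤⟨ *-monoˡ-≤ B (n<2^[1+⌊log₂n⌋] x) ⟩
      2 ^ suc ℓ * B          ∎)))

  absorb : ∀ k z b → k ≤ 16384 → c * z ≤ b → k * z ≤ b
  absorb k z b k≤ = ≤-trans (*-monoˡ-≤ z (≤-trans k≤ c-large))

  10ThP≤Nℓ : 10 * (T * h * P) ≤ N * ℓ
  10ThP≤Nℓ with h≤4ℓ⊎h≤2B
  -- An address costs only a multiple of ℓ here, so the term `N / P` of the minimum, in the form
  -- `cTP≤N`, bounds the total.
  ... | inj₁ h≤ = begin
    10 * (T * h * P)          ≤⟨ *-monoʳ-≤ 10 (*-monoˡ-≤ P (*-monoʳ-≤ T h≤)) ⟩
    10 * (T * (4 * ℓ) * P)    ≡⟨ rearrange T ℓ P ⟩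
    40 * (T * P) * ℓ
      ≤⟨ *-monoˡ-≤ ℓ (absorb 40 (T * P) N (toWitness {a? = 40 ≤? 16384} _) (≤-trans (≤-reflexive (sym (*-assoc c T P))) cTP≤N)) ⟩
    N * ℓ                     ∎
    where
    rearrange : ∀ a b c → 10 * (a * (4 * b) * c) ≡ 40 * (a * c) * b
    rearrange = solve-∀
  ... | inj₂ h≤ = begin
    10 * (T * h * P)          ≤⟨ *-monoʳ-≤ 10 (*-monoˡ-≤ P (*-monoʳ-≤ T h≤)) ⟩
    10 * (T * (2 * B) * P)    ≡⟨ rearrange T B P ⟩
    20 * (T * 1 * W)          ≤⟨ *-monoʳ-≤ 20 (*-monoˡ-≤ W (*-monoʳ-≤ T (s≤s {0} {g ∸ 1} z≤n))) ⟩
    20 * (T * g * W)          ≤⟨ absorb 20 (T * g * W) (N * ℓ) (toWitness {a? = 20 ≤? 16384} _) cTgW≤Nℓ ⟩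
    N * ℓ                     ∎
    where
    rearrange : ∀ a b c → 10 * (a * (2 * b) * c) ≡ 20 * (a * 1 * (c * b))
    rearrange = solve-∀

  e : ℕ
  e = suc (h * P + 3 * g * (W + W * 2))

  -- The 1 stands for the factor 2 of the half, `e * T` for the choices along a run, and `4 * n` for
  -- the factor `16 ^ n` lost in estimating `oddFactorial`. Multiplied by 20, the sum is at most 60
  -- N + 4 N ℓ, and `10≤ℓ` turns this into 10 N ℓ.
  exponents : 1 + e * T + 4 * n ≤ ℓ * n
  exponents = *-cancelˡ-≤ 20 (begin
    20 * (1 + e * T + 4 * n)                                            ≡⟨ expand T h P g W n ⟩
    10 * 2 + 20 * T + 2 * (10 * (T * h * P)) + 180 * (T * g * W) + 40 * N
      ≤⟨ +-monoˡ-≤ (40 * N) (+-mono-≤ (+-mono-≤ (+-mono-≤ (*-monoʳ-≤ 10 2≤N) 20T≤10N) (*-monoʳ-≤ 2 10ThP≤Nℓ)) 180TgW≤) ⟩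
    10 * N + 10 * N + 2 * (N * ℓ) + 2 * (N * ℓ) + 40 * N                ≡⟨ collect N ℓ ⟩
    6 * N * 10 + 4 * (N * ℓ)                                            ≤⟨ +-monoˡ-≤ (4 * (N * ℓ)) (*-monoʳ-≤ (6 * N) 10≤ℓ) ⟩
    6 * N * ℓ + 4 * (N * ℓ)                                             ≡⟨ finish n ℓ ⟩
    20 * (ℓ * n)                                                        ∎)
    where
    expand : ∀ T h P g W n → 20 * (1 + (1 + (h * P + 3 * g * (W + W * 2))) * T + 4 * n) ≡
             10 * 2 + 20 * T + 2 * (10 * (T * h * P)) + 180 * (T * g * W) + 40 * (2 * n)
    expand = solve-∀
    collect : ∀ N ℓ → 10 * N + 10 * N + 2 * (N * ℓ) + 2 * (N * ℓ) + 40 * N ≡ 6 * N * 10 + 4 * (N * ℓ)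
    collect = solve-∀
    finish : ∀ n ℓ → 6 * (2 * n) * ℓ + 4 * (2 * n * ℓ) ≡ 20 * (ℓ * n)
    finish = solve-∀
    20T≤10N : 20 * T ≤ 10 * N
    20T≤10N = ≤-trans (absorb 20 T N (toWitness {a? = 20 ≤? 16384} _) (≤-trans (m≤m*n (c * T) P) cTP≤N)) (m≤n*m N 10)
    180TgW≤ : 180 * (T * g * W) ≤ 2 * (N * ℓ)
    180TgW≤ = ≤-trans (absorb 180 (T * g * W) (N * ℓ) (toWitness {a? = 180 ≤? 16384} _) cTgW≤Nℓ) (m≤n*m (N * ℓ) 2)

  -- The same number as `branching`, to which it is definitionally equal.
  F : ℕ
  F = suc (suc N ^ P * suc (suc d) ^ (W + W * 2))

  F≤2^e : F ≤ 2 ^ e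
  F≤2^e = begin
    1 + suc N ^ P * suc (suc d) ^ (W + W * 2)      ≤⟨ +-mono-≤ (m^n>0 2 e′) (*-mono-≤ addresses transfers) ⟩
    2 ^ e′ + 2 ^ (h * P) * 2 ^ (3 * g * (W + W * 2))
      ≡⟨ cong (2 ^ e′ +_) (trans (sym (^-distribˡ-+-* 2 (h * P) (3 * g * (W + W * 2)))) (sym (+-identityʳ (2 ^ e′)))) ⟩
    2 ^ e                                          ∎
    where
    e′ = h * P + 3 * g * (W + W * 2)
    addresses : suc N ^ P ≤ 2 ^ (h * P)
    addresses = ≤-trans (^-monoˡ-≤ P (n<2^[1+⌊log₂n⌋] N)) (≤-reflexive (^-*-assoc 2 h P))
    transfers : suc (suc d) ^ (W + W * 2) ≤ 2 ^ (3 * g * (W + W * 2))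
    transfers = ≤-trans (^-monoˡ-≤ (W + W * 2) 2+d≤8^g) (≤-reflexive (^-*-assoc 2 (3 * g) (W + W * 2)))

  2*F^T*B^n≤oddFactorial : 2 * (F ^ T * B ^ n) ≤ oddFactorial n
  2*F^T*B^n≤oddFactorial = *-cancelˡ-≤ (2 ^ (4 * n)) {{m^n≢0 2 (4 * n)}} (begin
    2 ^ (4 * n) * (2 * (F ^ T * B ^ n))
      ≤⟨ *-monoʳ-≤ (2 ^ (4 * n)) (*-monoʳ-≤ 2 (*-monoˡ-≤ (B ^ n) (≤-trans (^-monoˡ-≤ T F≤2^e) (≤-reflexive (^-*-assoc 2 e T))))) ⟩
    2 ^ (4 * n) * (2 * (2 ^ (e * T) * B ^ n))        ≡⟨ rearrange (2 ^ (4 * n)) (2 ^ (e * T)) (B ^ n) ⟩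
    2 * 2 ^ (e * T) * 2 ^ (4 * n) * B ^ n            ≡⟨ cong (_* B ^ n) (^-distribˡ-+-* 2 (1 + e * T) (4 * n)) ⟨
    2 ^ (1 + e * T + 4 * n) * B ^ n                  ≤⟨ *-monoˡ-≤ (B ^ n) (^-monoʳ-≤ 2 exponents) ⟩
    2 ^ (ℓ * n) * B ^ n                              ≡⟨ cong (_* B ^ n) (^-*-assoc 2 ℓ n) ⟨
    (2 ^ ℓ) ^ n * B ^ n                              ≡⟨ ^-distribʳ-* n (2 ^ ℓ) B ⟨
    (2 ^ ℓ * B) ^ n
      ≤⟨ ^-monoˡ-≤ n (≤-trans (*-monoˡ-≤ B (2^⌊log₂n⌋≤n x (<-trans (s≤s z≤n) x>1))) (m/n*n≤m N B)) ⟩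
    N ^ n                                            ≤⟨ [2n]^n≤16^n*oddFactorial n ⟩
    16 ^ n * oddFactorial n                          ≡⟨ cong (_* oddFactorial n) (^-*-assoc 2 4 n) ⟩
    2 ^ (4 * n) * oddFactorial n                     ∎)
    where
    rearrange : ∀ a b c → a * (2 * (b * c)) ≡ 2 * b * a * c
    rearrange = solve-∀

-- Easy instances are at most half of all instances

module _ (c n P M B : ℕ) .{{_ : NonZero c}} .{{_ : NonZero P}} .{{_ : NonZero B}} (c-large : 16384 ≤ c) (PB<N : P * B < 2 * n)
      (B≤M : B ≤ M) where

  steps≤ : ∀ t → c * t < permNat (2 * n) M B P → t ≤ permNat (2 * n) M B P / c
  steps≤ t lt = ≤-trans (≤-reflexive (sym (m*n/n≡m t c))) (/-monoˡ-≤ c (≤-trans (≤-reflexive (*-comm t c)) (<⇒≤ lt)))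

  -- The quotient of `permNat` by `c`, rounded down, bounds the steps available to an easy instance.
  -- If it is zero, only the empty run remains and swapping labels applies; otherwise it serves as
  -- the `T` with `c * T` at most `permNat` on which the estimates rest.
  easy⇒half : (L : List (Labeling n)) → Unique L → All (λ v → ValidLabeling n v × EasyFor c n P M B v) L → 2 * length L ≤ numInstances n
  easy⇒half L u easy with permNat (2 * n) M B P / c in eq
  ... | zero = solvable-0⇒half n P M B (≤-<-trans (m≤n*m B P) PB<N) L u
    (All.map (λ { {v} (val , t , ct< , sol) → val , subst (SolvableIn n P M B v) (n≤0⇒n≡0 (≤-trans (steps≤ t ct<)
          (≤-reflexive eq))) sol }) easy)
  ... | T@(suc _) = begin
    2 * length L
      ≤⟨ *-monoʳ-≤ 2 (unique-⊆⇒length≤ u λ v∈ → let val , t , ct< , sol = All.lookup easy v∈ in ∈-candidates (≤-trans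
          (steps≤ t ct<) (≤-reflexive eq)) val sol) ⟩
    2 * length (candidates T)             ≤⟨ *-monoʳ-≤ 2 (length-candidates T) ⟩
    2 * (F ^ T * (n ! * B ^ n))           ≡⟨ rearrange (F ^ T) (n !) (B ^ n) ⟩
    n ! * (2 * (F ^ T * B ^ n))           ≤⟨ *-monoʳ-≤ (n !) 2*F^T*B^n≤oddFactorial ⟩
    n ! * oddFactorial n                  ≤⟨ numInstances-≥ n ⟩
    numInstances n                        ∎
    where
    open ≤-Reasoning
    cT≤ : c * T ≤ permNat (2 * n) M B P
    cT≤ = ≤-trans (≤-reflexive (trans (*-comm c T) (cong (_* c) (sym eq)))) (m/n*n≤m (permNat (2 * n) M B P) c)
    open Estimates c n P M B T c-large PB<N (s≤s z≤n) cT≤ using (F; d; d-large; 2*F^T*B^n≤oddFactorial)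
    open Counting n P M B d B≤M d-large using (candidates; length-candidates; ∈-candidates)
    rearrange : ∀ a b c → 2 * (a * (b * c)) ≡ b * (2 * (a * c))
    rearrange = solve-∀

theorem1 : Σ ℕ λ c → NonZero c × Σ ℕ λ N₀ →
    (n P M B : ℕ) → .{{_ : NonZero P}} → .{{_ : NonZero B}} →
    N₀ ≤ 2 * n → P * B < 2 * n → B ≤ M →
    (L : List (Labeling n)) → Unique L →
    All (λ λ' → ValidLabeling n λ' × EasyFor c n P M B λ') L →
    2 * length L ≤ numInstances n
theorem1 = 16384 , _ , 0 , λ n P M B _ PB<N B≤M → easy⇒half 16384 n P M B ≤-refl PB<N B≤M
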